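{- Up to Euclidean transformations, the only Eisenstein lattice equable parallelograms having a side of length $2\sqrt3$ or $4\sqrt3$ are, respectively, the parallelograms $Q_n$ ($n\ge1$) (for side length $2\sqrt3$) and the parallelograms $R_n$, $R'_n$ ($n\ge1$) (for side length $4\sqrt3$) defined in the context. Moreover, all Eisenstein lattice equable parallelograms with a vertical side have a side of length $2\sqrt3$ or $4\sqrt3$.
   Context: A planar polygon is equable if its perimeter equals its area. The Eisenstein lattice is $\mathbb{Z}[\omega]\subset\mathbb{C}$, where $\omega=-\frac12+i\frac{\sqrt3}{2}$. An Eisenstein lattice equable parallelogram (ELEP) is an equable parallelogram whose vertices all lie in $\mathbb{Z}[\omega]$. Vertical means parallel to the imaginary axis. Family with side $2\sqrt3$. Let $(u_n,m_n)_{n\ge1}$ be given by $(u_1,m_1)=(1,1)$, $(u_2,m_2)=(9,11)$ and $(u_n,m_n)=10(u_{n-1},m_{n-1})-(u_{n-2},m_{n-2})$ for $n\ge3$; these are the positive integer solutions $(u,m)$ of $3u^2=2m^2+1$. Put $x_n=3+3u_n$ and $y_n=2m_n$. $Q_n$ is the parallelogram with consecutive vertices $0,\ 2\sqrt3\,i,\ -x_n+(2+y_n)\sqrt3\,i,\ -x_n+y_n\sqrt3\,i$. It is an ELEP with a vertical side of length $2\sqrt3$. Families with side $4\sqrt3$. Consider sequences $(w_n,y_n)_{n\ge1}$ satisfying $$w_n=23w_{n-1}+2y_{n-1}+3,\qquad y_n=264w_{n-1}+23y_{n-1}+36\qquad(n\ge2),$$ with initial condition either $(w_1,y_1)=(1,13)$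 or $(w_1,y_1)=(5,59)$; together these two sequences give the positive integer solutions $(w,y)$ of $132w^2+36w+1=y^2$. Put $x_n=6w_n+3$ and consider the parallelogram with consecutive vertices $0,\ 4\sqrt3\,i,\ -x_n+(4+y_n)\sqrt3\,i,\ -x_n+y_n\sqrt3\,i$. It is an ELEP with a vertical side of length $4\sqrt3$. It is denoted $R_n$ for the sequence with $(w_1,y_1)=(1,13)$ and $R'_n$ for the sequence with $(w_1,y_1)=(5,59)$.
   Formalization: For side length 4√3 the formal statement also allows Q_1: Q_1 is an equable parallelogram with sides 2√3 and 4√3 but is congruent to no R_n or R'_n, so the claim that side 4√3 gives only R_n and R'_n is false as worded. -}

module Defs where

open import Level using (Level; suc; _⊔_)
open import Data.Nat.Base as ℕ using (ℕ)
open import Data.Integer.Base as ℤ using (ℤ; +_; -[1+_])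
open import Data.Fin.Base using (Fin)
open import Data.Fin.Patterns using (0F; 1F; 2F; 3F)
open import Data.Product.Base using (∃-syntax; Σ-syntax; _×_; _,_; proj₁; proj₂)
open import Data.Sum.Base using (_⊎_; inj₂)
open import Data.Vec.Functional using (Vector; []; _∷_)
open import Function.Bundles using (_⇔_; Equivalence)
open import Relation.Binary.Core using (Rel; _Preserves_⟶_)
open import Relation.Binary.Structures using (IsStrictPartialOrder)
open import Relation.Nullary.Negation using (¬_)
open import Algebra.Bundles using (CommutativeRing)
open import Algebra.Apartness.Bundles using (HeytingField; HeytingCommutativeRing)
import Algebra.Definitions.RawMonoid as RawMonoidDefinitions

-- The real numbers, given axiomatically as a Cauchy-complete Archimedean
-- ordered field.  The axioms are the constructively valid ones (no
-- decidability or totality of the order), so Cauchy reals are a model.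
-- The square root is determined on x ≥ 0 by the other axioms; outside that
-- range its value is irrelevant (√ (max x 0) is a possible choice).
record Reals (c ℓ₁ ℓ₂ : Level) : Set (suc (c ⊔ ℓ₁ ⊔ ℓ₂)) where
  field
    heytingField : HeytingField c ℓ₁ ℓ₂

  open HeytingField heytingField public

  commutativeRing : CommutativeRing c ℓ₁
  commutativeRing = HeytingCommutativeRing.commutativeRing heytingCommutativeRing

  open CommutativeRing commutativeRing public using (+-rawMonoid)
  open RawMonoidDefinitions +-rawMonoid public using (sum) renaming (_×_ to _·_)

  infix 4 _<_ _≤_
  field
    _<_                  : Rel Carrier ℓ₂
    isStrictPartialOrder : IsStrictPartialOrder _≈_ _<_
    #⇔<⊎>                : ∀ {x y} → (x # y) ⇔ (x < y ⊎ y < x)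
    0<1                  : 0# < 1#
    +-monoˡ-<            : ∀ {x y} z → x < y → x + z < y + z
    *-pos                : ∀ {x y} → 0# < x → 0# < y → 0# < x * y

  open IsStrictPartialOrder isStrictPartialOrder public
    using (<-respˡ-≈; <-respʳ-≈)
    renaming (irrefl to <-irrefl; trans to <-trans)

  _≤_ : Rel Carrier ℓ₂
  x ≤ y = ¬ (y < x)

  Within : Carrier → Rel Carrier ℓ₂
  Within ε x y = (x - y < ε) × (y - x < ε)

  IsCauchy : (ℕ → Carrier) → Set (c ⊔ ℓ₂)
  IsCauchy s = ∀ ε → 0# < ε →
    ∃[ N ] (∀ m n → N ℕ.≤ m → N ℕ.≤ n → Within ε (s m) (s n))

  ConvergesTo : (ℕ → Carrier) → Carrier → Set (c ⊔ ℓ₂)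
  ConvergesTo s l = ∀ ε → 0# < ε → ∃[ N ] (∀ n → N ℕ.≤ n → Within ε (s n) l)

  field
    archimedean : ∀ x → ∃[ n ] (x < n · 1#)
    complete    : ∀ s → IsCauchy s → ∃[ l ] ConvergesTo s l

    √_       : Carrier → Carrier
    √-cong   : √_ Preserves _≈_ ⟶ _≈_
    √-nonNeg : ∀ x → 0# ≤ √ x
    √-square : ∀ {x} → 0# ≤ x → √ x * √ x ≈ x

  infix 8 √_

  0<2 : 0# < 1# + 1#
  0<2 = <-trans 0<1 (<-respˡ-≈ (+-identityˡ 1#) (+-monoˡ-< 1# 0<1))

  2#0 : (1# + 1#) # 0#
  2#0 = Equivalence.from #⇔<⊎> (inj₂ 0<2)

  ½ : Carrier
  ½ = proj₁ (#⇒invertible 2#0)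

  fromℤ : ℤ → Carrier
  fromℤ (+ n)    = n · 1#
  fromℤ -[1+ n ] = - (ℕ.suc n · 1#)

  √3 : Carrier
  √3 = √ fromℤ (+ 3)

  ∣_∣ : Carrier → Carrier
  ∣ x ∣ = √ (x * x)

-- The index 0 is not used; its value makes the recurrence give
-- (u₂ , m₂) = (9 , 11).
u : ℕ → ℤ
u 0                     = + 1
u 1                     = + 1
u (ℕ.suc (ℕ.suc n)) = + 10 ℤ.* u (ℕ.suc n) ℤ.- u n

m : ℕ → ℤ
m 0                     = -[1+ 0 ]
m 1                     = + 1
m (ℕ.suc (ℕ.suc n)) = + 10 ℤ.* m (ℕ.suc n) ℤ.- m n

-- wy s n is (wₙ , yₙ) for the initial condition (w₁ , y₁) = s; again the
-- index 0 is not used.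
wy : ℤ × ℤ → ℕ → ℤ × ℤ
wy s 0 = s
wy s 1 = s
wy s (ℕ.suc (ℕ.suc n)) =
  let (w , y) = wy s (ℕ.suc n) in
    (+ 23 ℤ.* w ℤ.+ + 2 ℤ.* y ℤ.+ + 3)
  , (+ 264 ℤ.* w ℤ.+ + 23 ℤ.* y ℤ.+ + 36)

module Plane {c ℓ₁ ℓ₂ : Level} (ℝ : Reals c ℓ₁ ℓ₂) where
  open Reals ℝ

  record ℂ : Set c where
    constructor _+i_
    field
      re im : Carrier

  open ℂ public

  infix  5 _+i_
  infix  4 _≈ᶜ_ _≅_
  infixl 6 _+ᶜ_ _-ᶜ_
  infixl 7 _*ᶜ_

  _≈ᶜ_ : Rel ℂ ℓ₁
  z ≈ᶜ w = (re z ≈ re w) × (im z ≈ im w)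

  _+ᶜ_ _-ᶜ_ _*ᶜ_ : ℂ → ℂ → ℂ
  z +ᶜ w = (re z + re w) +i (im z + im w)
  z -ᶜ w = (re z - re w) +i (im z - im w)
  z *ᶜ w = (re z * re w - im z * im w) +i (re z * im w + im z * re w)

  fromℤᶜ : ℤ → ℂ
  fromℤᶜ a = fromℤ a +i 0#

  modulus : ℂ → Carrier
  modulus z = √ (re z * re z + im z * im z)

  dist : ℂ → ℂ → Carrier
  dist z w = modulus (z -ᶜ w)

  ω : ℂ
  ω = (- ½) +i (½ * √3)

  _∈ℤ[ω] : ℂ → Set ℓ₁
  z ∈ℤ[ω] = ∃[ a ] ∃[ b ] (z ≈ᶜ fromℤᶜ a +ᶜ fromℤᶜ b *ᶜ ω)

  -- A quadrilateral is given by its consecutive vertices.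
  Quadrilateral : Set c
  Quadrilateral = Vector ℂ 4

  next : Fin 4 → Fin 4
  next 0F = 1F
  next 1F = 2F
  next 2F = 3F
  next 3F = 0F

  side : Quadrilateral → Fin 4 → ℂ
  side P i = P (next i) -ᶜ P i

  -- The signed area spanned by two vectors.
  cross : ℂ → ℂ → Carrier
  cross z w = re z * im w - im z * re w

  -- Nondegenerate: the vertices are not collinear.
  IsParallelogram : Quadrilateral → Set (ℓ₁ ⊔ ℓ₂)
  IsParallelogram P =
    (P 1F -ᶜ P 0F ≈ᶜ P 2F -ᶜ P 3F) × (cross (side P 0F) (side P 1F) # 0#)

  perimeter : Quadrilateral → Carrier
  perimeter P = sum (λ i → modulus (side P i))

  -- This is the area of P only when P is a parallelogram.
  area : Quadrilateral → Carrier
  area P = ∣ cross (side P 0F) (side P 1F) ∣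

  IsELEP : Quadrilateral → Set (ℓ₁ ⊔ ℓ₂)
  IsELEP P = IsParallelogram P × (∀ i → P i ∈ℤ[ω]) × (perimeter P ≈ area P)

  HasSideOfLength : Carrier → Quadrilateral → Set ℓ₁
  HasSideOfLength l P = ∃[ i ] (modulus (side P i) ≈ l)

  HasVerticalSide : Quadrilateral → Set ℓ₁
  HasVerticalSide P = ∃[ i ] (re (side P i) ≈ 0#)

  IsEuclideanTransformation : (ℂ → ℂ) → Set (c ⊔ ℓ₁)
  IsEuclideanTransformation f = ∀ z w → dist (f z) (f w) ≈ dist z w

  -- P ≅ Q: some Euclidean transformation (possibly orientation-reversing)
  -- maps the vertex set of P onto that of Q.  A parallelogram is the convex
  -- hull of its vertices, so this does not depend on how they are labelled.
  _≅_ : Quadrilateral → Quadrilateral → Set (c ⊔ ℓ₁)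
  P ≅ Q = Σ[ f ∈ (ℂ → ℂ) ] IsEuclideanTransformation f
    × (∀ i → ∃[ j ] (f (P i) ≈ᶜ Q j))
    × (∀ j → ∃[ i ] (f (P i) ≈ᶜ Q j))

  _⊹_√3i : ℤ → ℤ → ℂ
  a ⊹ b √3i = fromℤ a +i (fromℤ b * √3)

  -- The parallelogram with vertices 0, k√3 i, -x + (k + y)√3 i, -x + y√3 i.
  verticalParallelogram : (k x y : ℤ) → Quadrilateral
  verticalParallelogram k x y =
      ((+ 0) ⊹ (+ 0) √3i)
    ∷ ((+ 0) ⊹ k √3i)
    ∷ ((ℤ.- x) ⊹ (k ℤ.+ y) √3i)
    ∷ ((ℤ.- x) ⊹ y √3i)
    ∷ []

  Q : ℕ → Quadrilateral
  Q n = verticalParallelogram (+ 2) (+ 3 ℤ.+ + 3 ℤ.* u n) (+ 2 ℤ.* m n)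

  familyWithSide4√3 : ℤ × ℤ → ℕ → Quadrilateral
  familyWithSide4√3 s n =
    let (w , y) = wy s n in
    verticalParallelogram (+ 4) (+ 6 ℤ.* w ℤ.+ + 3) y

  R R′ : ℕ → Quadrilateral
  R  = familyWithSide4√3 (+ 1 , + 13)
  R′ = familyWithSide4√3 (+ 5 , + 59)

  2√3 4√3 : Carrier
  2√3 = fromℤ (+ 2) * √3
  4√3 = fromℤ (+ 4) * √3

{-# OPTIONS --safe #-}

module Submission where

-- Write two adjacent sides as Eisenstein integers α and β.  Squaring the equation
-- 2 (∣ α ∣ + ∣ β ∣) = area twice shows that 3 ∣ β ∣² is a rational, hence an integral,
-- square; so ∣ α ∣ = r√3, ∣ β ∣ = t√3 and the determinant of (α , β) is ± 4 (r + t).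
-- Writing this determinant as 3 r X and twice the inner product as 3 r y, which is
-- possible if α is vertical or r ∈ {2 , 4}, Lagrange's identity becomes
--   r² (3X - 4)² = 4 (3X² + y²).
-- For fixed r this is a Pell equation with the norm-one unit
-- ((3r² - 2) + r √(9r² - 12)) / 2.  Multiplication by the inverse unit decreases X as
-- long as y > 2r, and preserves y ≥ -2r.  A solution with ∣ y ∣ ≤ 2r satisfies
-- (3r² - 4) X ≤ 8r², which forces r = 2, (X , y) = (4 , ± 4) or r = 4,
-- (X , y) = (2 , ± 2).  The orbits of these solutions are the families Q, R, R′, the
-- solution r = 4, (X , y) = (2 , 2) being Q 1 seen from its longer side.

open import Defs
open import Data.Empty using (⊥; ⊥-elim)
open import Data.Product.Base using (∃-syntax; _×_; _,_; proj₁; proj₂)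
open import Data.Sum.Base as Sum using (_⊎_; inj₁; inj₂)
open import Relation.Nullary using (yes; no)

-- Why the threshold is 2r: with Z = (3r² - 4)X - 4r² the equation becomes 3Z² = 64r² + 4(3r² -
-- 4)y². The inverse unit sends X to X′ with 2(X - X′) = 2ry - Z, and 3(2ry)² - 3Z² = 16(y² - 4r²).
-- So for y > 0 and Z ≥ 0 the coordinate X drops exactly when y > 2r, while y = 2r is sent to y′ =
-- -2r with X unchanged.
--
-- The obstacle is integrality: the unit has half-integral coefficients and X is not the natural
-- Pell coordinate, so a step could leave ℤ. For even r it does not; for odd r the equation itself
-- excludes the bad parities of X / 4 and y / 2.
--
-- On the real side the axioms give no decidable order. Square roots are therefore identified only
-- with strictly positive candidates, and the case analysis of the classification takes place in ℤ,
-- once the lengths are known to be integer multiples of √3.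

module Integers where

  open import Data.Nat.Base as ℕ using (ℕ; s≤s; z≤n)
  import Data.Nat.Properties as ℕ
  import Data.Nat.Divisibility as ℕ
  open import Data.Nat.Coprimality using (Coprime; coprime-divisor; coprime-/gcd)
  open import Data.Nat.DivMod using (m/n*n≡m)
  open import Data.Nat.GCD using (gcd; gcd[m,n]∣m; gcd[m,n]∣n; gcd[m,n]≢0)
  open import Data.Nat.Primality using (Prime; prime?; prime[2]; euclidsLemma)
  open import Data.Integer.Base hiding (suc)
  open import Data.Integer.Properties
  open import Data.Integer.DivMod using (_%ℕ_; _/ℕ_; n%ℕd<d; a≡a%ℕn+[a/ℕn]*n)
  open import Data.Integer.Tactic.RingSolver using (solve; solve-∀)
  open import Data.List.Base using ([]; _∷_)
  open import Data.Sum.Base using (reduce)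
  open import Function.Base using (_∘_)
  open import Relation.Binary.PropositionalEquality
  open import Relation.Nullary.Decidable using (from-yes)

  -- Arithmetic of ℤ: certificates, order, parity

  -- Certificate style used throughout: a consequence of an equation is proved by exhibiting its
  -- cofactor `c`, which leaves a polynomial identity to the ring solver.
  linear : ∀ c {a b l r} → a ≡ b → l - r ≡ c * (a - b) → l ≡ r
  linear c {a} {l = l} {r} refl eq = i-j≡0⇒i≡j l r (begin
    l - r       ≡⟨ eq ⟩
    c * (a - a) ≡⟨ cong (c *_) (i≡j⇒i-j≡0 {a} refl) ⟩
    c * 0ℤ      ≡⟨ *-zeroʳ c ⟩
    0ℤ          ∎)
    where open ≡-Reasoning

  linear₂ : ∀ c d {a b a′ b′ l r} → a ≡ b → a′ ≡ b′ →
            l - r ≡ c * (a - b) + d * (a′ - b′) → l ≡ r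
  linear₂ c d {a} {a′ = a′} {l = l} {r} refl refl eq =
    linear c {a} {a} refl (trans eq (solve (a ∷ a′ ∷ c ∷ d ∷ [])))

  0≤-+ : ∀ {x y} → 0ℤ ≤ x → 0ℤ ≤ y → 0ℤ ≤ x + y
  0≤-+ = +-mono-≤

  0<-+ : ∀ {x y} → 0ℤ < x → 0ℤ ≤ y → 0ℤ < x + y
  0<-+ = +-mono-<-≤

  0≤-* : ∀ {x y} → 0ℤ ≤ x → 0ℤ ≤ y → 0ℤ ≤ x * y
  0≤-* {+ m} {+ n} _ _ = subst (0ℤ ≤_) (pos-* m n) (+≤+ z≤n)

  0<-* : ∀ {x y} → 0ℤ < x → 0ℤ < y → 0ℤ < x * y
  0<-* (+<+ (s≤s z≤n)) (+<+ (s≤s z≤n)) = +<+ (s≤s z≤n)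

  i<j⇒0<j-i : ∀ {i j} → i < j → 0ℤ < j - i
  i<j⇒0<j-i {i} {j} i<j =
    subst (_< j - i) (i≡j⇒i-j≡0 {i} refl) (+-monoˡ-< (- i) i<j)

  0<j-i⇒i<j : ∀ {i j} → 0ℤ < j - i → i < j
  0<j-i⇒i<j {i} {j} 0<j-i = subst₂ _<_ (+-identityˡ i) j-i+i≡j (+-monoˡ-< i 0<j-i)
    where
    j-i+i≡j : j - i + i ≡ j
    j-i+i≡j = solve (i ∷ j ∷ [])

  0≤+ : ∀ {n} → 0ℤ ≤ + n
  0≤+ = +≤+ z≤n

  0<+suc : ∀ {n} → 0ℤ < +[1+ n ]
  0<+suc = +<+ (s≤s z≤n)

  0≤-square : ∀ x → 0ℤ ≤ x * x
  0≤-square (+ n)    = 0≤-* {+ n} 0≤+ 0≤+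
  0≤-square -[1+ n ] = 0≤+

  -- Used to compare multiples of Z with multiples of y through their squares. The factor 3 is the
  -- coefficient of Z² in `pell`, so that after substitution the difference `d` is an explicit
  -- polynomial of visible sign.
  square-reflects-< : ∀ {a b d} → 0ℤ ≤ b → 0ℤ < d →
                      + 3 * (b * b) - + 3 * (a * a) ≡ d → a < b
  square-reflects-< {a} {b} {d} 0≤b 0<d eq with a <? b
  ... | yes a<b = a<b
  ... | no a≮b  = ⊥-elim (<⇒≱ 0<d (subst (_≤ 0ℤ) (trans factor eq)
    (neg-mono-≤ (0≤-* {+ 3} 0≤+ (0≤-* 0≤a-b (0≤-+ (≤-trans 0≤b (≮⇒≥ a≮b)) 0≤b))))))
    where
    0≤a-b = i≤j⇒0≤j-i (≮⇒≥ a≮b)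
    factor : - (+ 3 * ((a - b) * (a + b))) ≡ + 3 * (b * b) - + 3 * (a * a)
    factor = solve (a ∷ b ∷ [])

  square-reflects-≤ : ∀ {a b d} → 0ℤ ≤ b → 0ℤ ≤ d →
                      + 3 * (b * b) - + 3 * (a * a) ≡ d → a ≤ b
  square-reflects-≤ {a} {b} {d} 0≤b 0≤d eq with a ≤? b
  ... | yes a≤b = a≤b
  ... | no a≰b  = ⊥-elim (≤⇒≯ 0≤d (subst (_< 0ℤ) (trans factor eq)
    (neg-mono-< (0<-* {+ 3} 0<+suc (0<-* 0<a-b (0<-+ (≤-<-trans 0≤b (≰⇒> a≰b)) 0≤b))))))
    where
    0<a-b = i<j⇒0<j-i (≰⇒> a≰b)
    factor : - (+ 3 * ((a - b) * (a + b))) ≡ + 3 * (b * b) - + 3 * (a * a)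
    factor = solve (a ∷ b ∷ [])

  even≢odd : ∀ a b → + 2 * a ≢ + 1 + + 2 * b
  even≢odd a b eq = two-∤-one ∣ a - b ∣ (trans (sym (abs-* (+ 2) (a - b))) (cong ∣_∣ doubled))
    where
    doubled : + 2 * (a - b) ≡ + 1
    doubled = linear (+ 1) eq (solve (a ∷ b ∷ []))
    two-∤-one : ∀ n → 2 ℕ.* n ≢ 1
    two-∤-one (ℕ.suc n) eq with () ← trans (sym (ℕ.+-suc n (n ℕ.+ 0))) (ℕ.suc-injective eq)

  even⊎odd : ∀ z → (∃[ a ] z ≡ + 2 * a) ⊎ (∃[ a ] z ≡ + 1 + + 2 * a)
  even⊎odd z with z %ℕ 2 | n%ℕd<d z 2 | a≡a%ℕn+[a/ℕn]*n z 2
  ... | 0 | _ | eq = inj₁ (z /ℕ 2 , trans eq (trans (+-identityˡ _) (*-comm (z /ℕ 2) (+ 2))))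
  ... | 1 | _ | eq = inj₂ (z /ℕ 2 , trans eq (cong (_+_ (+ 1)) (*-comm (z /ℕ 2) (+ 2))))
  ... | ℕ.suc (ℕ.suc _) | s≤s (s≤s ()) | _

  square≡⇒≡± : ∀ {a b} → a * a ≡ b * b → (a ≡ b) ⊎ (a ≡ - b)
  square≡⇒≡± {a} {b} eq with i*j≡0⇒i≡0∨j≡0 (a - b) {a + b} (linear (+ 1) eq (solve (a ∷ b ∷ [])))
  ... | inj₁ a-b≡0 = inj₁ (i-j≡0⇒i≡j a b a-b≡0)
  ... | inj₂ a+b≡0 = inj₂ (linear (+ 1) a+b≡0 (solve (a ∷ b ∷ [])))

  -- The Pell equation and multiplication by the inverse unit

  -- Lagrange's identity for a side of length r√3: the determinant of the two sides
  -- is ± 3 r X, twice their inner product is ± 3 r y, and the other side has length t√3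
  -- with 4 t = r (3 X - 4).
  Equable : ℤ → ℤ → ℤ → Set
  Equable r X y = r * r * ((+ 3 * X - + 4) * (+ 3 * X - + 4)) ≡ + 4 * (+ 3 * (X * X) + y * y)

  -- The divisibility that makes the halves and quarters in Step integral; for odd r it
  -- follows from 4 ∣ r (3 X - 4) and X ≡ y mod 2.
  Integral : ℤ → ℤ → ℤ → Set
  Integral r X y = (∃[ ρ ] r ≡ + 2 * ρ)
                 ⊎ ((∃[ σ ] r ≡ + 1 + + 2 * σ) × (∃[ v ] X ≡ + 4 * v) × (∃[ p ] y ≡ + 2 * p))

  -- Multiplication by the unit ((3r² - 2) - r √(9r² - 12)) / 2, written in the
  -- coordinates (X , y) instead of (3 (3r² - 4) X - 12 r² , 2 y).
  Step : ℤ → ℤ → ℤ → ℤ → ℤ → Set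
  Step r X y X′ y′ = + 2 * X′ ≡ (+ 3 * r * r - + 2) * X - + 4 * r * r - + 2 * r * y
                   × + 4 * y′ ≡ + 2 * (+ 3 * r * r - + 2) * y - + 3 * r * (+ 3 * r * r - + 4) * X
                                + + 12 * r * r * r

  -- The unit has norm one, so the quadratic form is preserved. The identity is checked with cleared
  -- denominators, `P` standing for 2X′ and `T` for 4y′.
  step-equable : ∀ {r X y X′ y′} → Equable r X y → Step r X y X′ y′ → Equable r X′ y′
  step-equable {r} {X} {y} {X′} {y′} e (eX , ey) =
    let P = (+ 3 * r * r - + 2) * X - + 4 * r * r - + 2 * r * y
        T = + 2 * (+ 3 * r * r - + 2) * y - + 3 * r * (+ 3 * r * r - + 4) * X + + 12 * r * r * r
        invariant : r * r * ((+ 3 * P - + 8) * (+ 3 * P - + 8)) ≡ + 12 * (P * P) + T * T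
        invariant = linear (+ 4) e (solve (r ∷ X ∷ y ∷ []))
        open ≡-Reasoning
    in *-cancelˡ-≡ (+ 4) _ _ (begin
    + 4 * (r * r * ((+ 3 * X′ - + 4) * (+ 3 * X′ - + 4)))
      ≡⟨ solve (r ∷ X′ ∷ []) ⟩
    r * r * ((+ 3 * (+ 2 * X′) - + 8) * (+ 3 * (+ 2 * X′) - + 8))
      ≡⟨ cong (λ P → r * r * ((+ 3 * P - + 8) * (+ 3 * P - + 8))) eX ⟩
    r * r * ((+ 3 * P - + 8) * (+ 3 * P - + 8))
      ≡⟨ invariant ⟩
    + 12 * (P * P) + T * T
      ≡⟨ cong₂ (λ P T → + 12 * (P * P) + T * T) eX ey ⟨
    + 12 * ((+ 2 * X′) * (+ 2 * X′)) + (+ 4 * y′) * (+ 4 * y′)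
      ≡⟨ solve (X′ ∷ y′ ∷ []) ⟩
    + 4 * (+ 4 * (+ 3 * (X′ * X′) + y′ * y′)) ∎)

  -- For odd r, X = 4v and y = 2p, the new coordinates are again of this shape as soon as v and p
  -- have opposite parity. Equal parities contradict the equation: divided by 16, it equates an even
  -- and an odd number.
  odd-step : ∀ σ v p → let r = + 1 + + 2 * σ in
             Equable r (+ 4 * v) (+ 2 * p) →
             (∃[ a ] v ≡ + 2 * a) ⊎ (∃[ a ] v ≡ + 1 + + 2 * a) →
             (∃[ b ] p ≡ + 2 * b) ⊎ (∃[ b ] p ≡ + 1 + + 2 * b) →
             ∃[ X′ ] ∃[ y′ ] (Step r (+ 4 * v) (+ 2 * p) X′ y′ × Integral r X′ y′)
  odd-step σ _ _ e (inj₁ (a , refl)) (inj₁ (b , refl)) =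
    let k = + 3 * a - + 1 + + 6 * a * σ - σ
        m = + 24 * (a * a) + + 2 * (b * b)
        n = + 2 * (k * k) + + 2 * k
        parity : + 16 * (+ 2 * m) ≡ + 16 * (+ 1 + + 2 * n)
        parity = linear (- + 1) e (solve (σ ∷ a ∷ b ∷ []))
    in ⊥-elim (even≢odd m n (*-cancelˡ-≡ (+ 16) (+ 2 * m) (+ 1 + + 2 * n) parity))
  odd-step σ _ _ e (inj₂ (a , refl)) (inj₂ (b , refl)) =
    let v = + 1 + + 2 * a
        k = (+ 1 + + 2 * σ) * (+ 3 * a + + 1)
        m = + 2 * (k * k)
        n = + 6 * (v * v) + + 2 * (b * b) + + 2 * b
        parity : + 16 * (+ 2 * m) ≡ + 16 * (+ 1 + + 2 * n)
        parity = linear (+ 1) e (solve (σ ∷ a ∷ b ∷ []))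
    in ⊥-elim (even≢odd m n (*-cancelˡ-≡ (+ 16) (+ 2 * m) (+ 1 + + 2 * n) parity))
  odd-step σ _ _ e (inj₁ (a , refl)) (inj₂ (b , refl)) =
    let r = + 1 + + 2 * σ
        v′ = (+ 3 * r * r - + 2) * a - r * (σ + b + + 1)
        p′ = (+ 3 * r * r - + 2) * b - + 3 * r * (+ 3 * r * r - + 4) * a
           + (+ 12 * σ * σ * σ + + 24 * σ * σ + + 15 * σ + + 2)
    in + 4 * v′ , + 2 * p′ ,
       (solve (σ ∷ a ∷ b ∷ []) , solve (σ ∷ a ∷ b ∷ [])) ,
       inj₂ ((σ , refl) , (v′ , refl) , (p′ , refl))
  odd-step σ _ _ e (inj₂ (a , refl)) (inj₁ (b , refl)) =
    let r = + 1 + + 2 * σ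
        v′ = (+ 3 * r * r - + 2) * a + r * r - + 1 - r * b
        p′ = (+ 3 * r * r - + 2) * b - + 3 * r * (+ 3 * r * r - + 4) * a + + 3 * r * (+ 2 - r * r)
    in + 4 * v′ , + 2 * p′ ,
       (solve (σ ∷ a ∷ b ∷ []) , solve (σ ∷ a ∷ b ∷ [])) ,
       inj₂ ((σ , refl) , (v′ , refl) , (p′ , refl))

  step : ∀ {r X y} → Equable r X y → Integral r X y →
         ∃[ X′ ] ∃[ y′ ] (Step r X y X′ y′ × Integral r X′ y′)
  step {X = X} {y} e (inj₁ (ρ , refl)) =
    (+ 6 * ρ * ρ - + 1) * X - + 8 * ρ * ρ - + 2 * ρ * y ,
    (+ 6 * ρ * ρ - + 1) * y - + 3 * ρ * (+ 6 * ρ * ρ - + 2) * X + + 24 * ρ * ρ * ρ ,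
    (solve (ρ ∷ X ∷ y ∷ []) , solve (ρ ∷ X ∷ y ∷ [])) ,
    inj₁ (ρ , refl)
  step e (inj₂ ((σ , refl) , (v , refl) , (p , refl))) = odd-step σ v p e (even⊎odd v) (even⊎odd p)

  -- Inequalities along a step

  module _ {r X : ℤ} (2≤r : + 2 ≤ r) (2≤X : + 2 ≤ X) where

    private
      0≤r-2 : 0ℤ ≤ r - + 2
      0≤r-2 = i≤j⇒0≤j-i 2≤r
      0<r : 0ℤ < r
      0<r = <-≤-trans 0<+suc 2≤r
      0≤r : 0ℤ ≤ r
      0≤r = <⇒≤ 0<r

    0<3r²-4 : 0ℤ < + 3 * r * r - + 4
    0<3r²-4 = subst (0ℤ <_) eq (0<-+ {+ 8} 0<+suc (0≤-* {+ 3} 0≤+ (0≤-* 0≤r-2 (0≤-+ 0≤r (0≤+ {2})))))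
      where
      eq : + 8 + + 3 * ((r - + 2) * (r + + 2)) ≡ + 3 * r * r - + 4
      eq = solve (r ∷ [])

    -- Completing the square in X, after multiplying the equation by 3r² - 4.
    pell : ∀ {y} → Equable r X y → let Z = (+ 3 * r * r - + 4) * X - + 4 * r * r in
           + 3 * (Z * Z) ≡ + 64 * r * r + + 4 * (+ 3 * r * r - + 4) * (y * y)
    pell {y} e = linear (+ 3 * r * r - + 4) e (solve (r ∷ X ∷ y ∷ []))

    -- Here the bound X ≥ 2 enters: Z increases with X and equals 2(r² - 4) at X = 2. It fixes the
    -- sign of Z, so squares can be compared.
    0≤Z : 0ℤ ≤ (+ 3 * r * r - + 4) * X - + 4 * r * r
    0≤Z = subst (0ℤ ≤_) eq (0≤-+ (0≤-* (<⇒≤ 0<3r²-4) (i≤j⇒0≤j-i 2≤X))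
            (0≤-* {+ 2} 0≤+ (0≤-* 0≤r-2 (0≤-+ 0≤r (0≤+ {2})))))
      where
      eq : (+ 3 * r * r - + 4) * (X - + 2) + + 2 * ((r - + 2) * (r + + 2)) ≡
           (+ 3 * r * r - + 4) * X - + 4 * r * r
      eq = solve (r ∷ X ∷ [])

    -- By `pell`, 3(4r²)² - 3Z² = 4(3r² - 4)(4r² - y²), so Z ≤ 4r² inside the strip.
    base-bound : ∀ {y} → Equable r X y → - (+ 2 * r) ≤ y → y ≤ + 2 * r →
                 (+ 3 * r * r - + 4) * X ≤ + 8 * r * r
    base-bound {y} e -2r≤y y≤2r = 0≤i-j⇒j≤i (subst (0ℤ ≤_) eq (i≤j⇒0≤j-i
      (square-reflects-≤ {(+ 3 * r * r - + 4) * X - + 4 * r * r} {+ 4 * r * r}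
         {+ 4 * (+ 3 * r * r - + 4) * ((+ 2 * r - y) * (y - - (+ 2 * r)))}
         (0≤-* (0≤-* {+ 4} 0≤+ 0≤r) 0≤r)
         (0≤-* (0≤-* {+ 4} 0≤+ (<⇒≤ 0<3r²-4)) (0≤-* (i≤j⇒0≤j-i y≤2r) (i≤j⇒0≤j-i -2r≤y)))
         (linear (- + 1) (pell {y} e) (solve (r ∷ X ∷ y ∷ []))))))
      where
      eq : + 4 * r * r - ((+ 3 * r * r - + 4) * X - + 4 * r * r) ≡
           + 8 * r * r - (+ 3 * r * r - + 4) * X
      eq = solve (r ∷ X ∷ [])

    module _ {y X′ y′ : ℤ} (e : Equable r X y) (2r<y : + 2 * r < y) (s : Step r X y X′ y′) where

      private
        eX : + 2 * X′ ≡ (+ 3 * r * r - + 2) * X - + 4 * r * r - + 2 * r * y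
        eX = proj₁ s
        ey : + 4 * y′ ≡ + 2 * (+ 3 * r * r - + 2) * y - + 3 * r * (+ 3 * r * r - + 4) * X
                        + + 12 * r * r * r
        ey = proj₂ s
        0<y-2r : 0ℤ < y - + 2 * r
        0<y-2r = i<j⇒0<j-i 2r<y
        0<2r : 0ℤ < + 2 * r
        0<2r = 0<-* {+ 2} 0<+suc 0<r
        0<y : 0ℤ < y
        0<y = <-trans 0<2r 2r<y
        0<3r²-2 : 0ℤ < + 3 * r * r - + 2
        0<3r²-2 = subst (0ℤ <_) eq (0<-+ {+ 3 * r * r - + 4} {+ 2} 0<3r²-4 0≤+)
          where
          eq : + 3 * r * r - + 4 + + 2 ≡ + 3 * r * r - + 2
          eq = solve (r ∷ [])

      step-decreases : X′ < X
      step-decreases = *-cancelˡ-<-nonNeg {X′} {X} (+ 2) (0<j-i⇒i<j {+ 2 * X′} {+ 2 * X} (subst (0ℤ <_)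
        gap
        (i<j⇒0<j-i (square-reflects-< {(+ 3 * r * r - + 4) * X - + 4 * r * r} {+ 2 * r * y}
          {+ 16 * ((y - + 2 * r) * (y + + 2 * r))}
          (0≤-* (<⇒≤ 0<2r) (<⇒≤ 0<y))
          (0<-* {+ 16} 0<+suc (0<-* 0<y-2r (0<-+ 0<y (<⇒≤ 0<2r))))
          (linear (- + 1) (pell {y} e) (solve (r ∷ X ∷ y ∷ [])))))))
        where
        gap : + 2 * r * y - ((+ 3 * r * r - + 4) * X - + 4 * r * r) ≡ + 2 * X - + 2 * X′
        gap = linear (+ 1) eX (solve (r ∷ X ∷ y ∷ X′ ∷ []))

      -- At X′ = 1 the value of Z′ would be -(r² + 4), so it is enough that Z′ > 0. Now 2Z′ = (3r² -
      -- 2)Z - 2r(3r² - 4)y, and the squares of these two terms compare the right way because the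
      -- unit has norm one.
      step-≥2 : + 2 ≤ X′
      step-≥2 with + 2 ≤? X′
      ... | yes p = p
      ... | no p = ⊥-elim (<⇒≱ total (neg-mono-≤ {+0} (0≤-+ (0≤-* {+ 2} 0≤+ (0≤-* 0≤r 0≤r)) (0≤+ {8}))))
        where
        0≤1-X′ : 0ℤ ≤ + 1 - X′
        0≤1-X′ = i≤j⇒0≤j-i (i<j⇒i≤pred[j] (≰⇒> p))
        0<2Z′ : 0ℤ < (+ 3 * r * r - + 2) * ((+ 3 * r * r - + 4) * X - + 4 * r * r)
                    - + 2 * r * (+ 3 * r * r - + 4) * y
        0<2Z′ = i<j⇒0<j-i (square-reflects-<
          {+ 2 * r * (+ 3 * r * r - + 4) * y}
          {(+ 3 * r * r - + 2) * ((+ 3 * r * r - + 4) * X - + 4 * r * r)}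
          {+ 16 * (+ 3 * r * r - + 4) * (y * y) + + 64 * ((+ 3 * r * r - + 2) * (+ 3 * r * r - + 2) * (r * r))}
          (0≤-* (<⇒≤ 0<3r²-2) 0≤Z)
          (0<-+ (0<-* (0<-* {+ 16} 0<+suc 0<3r²-4) (0<-* 0<y 0<y))
                (0≤-* {+ 64} 0≤+ (0≤-* (0≤-square (+ 3 * r * r - + 2)) (0≤-square r))))
          (linear ((+ 3 * r * r - + 2) * (+ 3 * r * r - + 2)) (pell {y} e) (solve (r ∷ X ∷ y ∷ []))))
        total : 0ℤ < - (+ 2 * (r * r) + + 8)
        gap : ((+ 3 * r * r - + 2) * ((+ 3 * r * r - + 4) * X - + 4 * r * r)
                - + 2 * r * (+ 3 * r * r - + 4) * y) + + 2 * (+ 3 * r * r - + 4) * (+ 1 - X′)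
              ≡ - (+ 2 * (r * r) + + 8)
        gap = linear (- (+ 3 * r * r - + 4)) eX (solve (r ∷ X ∷ y ∷ X′ ∷ []))
        total = subst (0ℤ <_) gap
          (0<-+ 0<2Z′ (0≤-* {+ 2 * (+ 3 * r * r - + 4)} (0≤-* {+ 2} 0≤+ (<⇒≤ 0<3r²-4)) 0≤1-X′))

      -- 4(y′ + 2r) = 2(3r² - 2)y + 8r - 3rZ. The difference of the squares is a polynomial in y -
      -- 2r with nonnegative coefficients that vanishes at y = 2r, the point sent to y′ = -2r.
      step-≥-2r : - (+ 2 * r) ≤ y′
      step-≥-2r = <⇒≤ (*-cancelˡ-<-nonNeg { - (+ 2 * r)} {y′} (+ 4) (0<j-i⇒i<j {+ 4 * - (+ 2 * r)} {+ 4 * y′} (subst (0ℤ <_)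
        gap
        (i<j⇒0<j-i (square-reflects-<
          {+ 3 * r * ((+ 3 * r * r - + 4) * X - + 4 * r * r)}
          {+ 2 * (+ 3 * r * r - + 2) * y + + 8 * r}
          {+ 48 * ((y - + 2 * r) * (y - + 2 * r)) + + 288 * (r * r * r * (y - + 2 * r))}
          (0≤-+ (0≤-* (0≤-* {+ 2} 0≤+ (<⇒≤ 0<3r²-2)) (<⇒≤ 0<y)) (0≤-* {+ 8} 0≤+ 0≤r))
          (0<-+ (0<-* {+ 48} 0<+suc (0<-* 0<y-2r 0<y-2r))
                (0≤-* {+ 288} 0≤+ (0≤-* (0≤-* (0≤-* 0≤r 0≤r) 0≤r) (<⇒≤ 0<y-2r))))
          (linear (- (+ 9 * r * r)) (pell {y} e) (solve (r ∷ X ∷ y ∷ []))))))))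
        where
        gap : + 2 * (+ 3 * r * r - + 2) * y + + 8 * r - + 3 * r * ((+ 3 * r * r - + 4) * X - + 4 * r * r)
              ≡ + 4 * y′ - + 4 * - (+ 2 * r)
        gap = linear (- + 1) ey (solve (r ∷ X ∷ y ∷ y′ ∷ []))

  -- Descent to the strip

  module _ {ℓ} {r} (2≤r : + 2 ≤ r) (C : ℤ → ℤ → Set ℓ)
    (base : ∀ {X y} → Equable r X y → Integral r X y → + 2 ≤ X → - (+ 2 * r) ≤ y → y ≤ + 2 * r → C X y)
    (inherit : ∀ {X y X′ y′} → Step r X y X′ y′ → C X′ y′ → C X y)
    where

    private
      -- Induction on a strict upper bound for X. The claim `C` is left abstract because the descent
      -- serves twice: with a constant claim it restricts r, and with membership in an orbit it
      -- lists the solutions for r = 2 and r = 4.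
      below : ∀ n {X y} → X < + n → Equable r X y → Integral r X y → + 2 ≤ X → - (+ 2 * r) ≤ y → C X y
      below ℕ.zero    X<0 _ _ 2≤X _ = ⊥-elim (<⇒≱ X<0 (≤-trans 0≤+ 2≤X))
      below (ℕ.suc n) {X} {y} X<n+1 e int 2≤X -2r≤y with y ≤? + 2 * r
      ... | yes y≤2r = base {X} {y} e int 2≤X -2r≤y y≤2r
      ... | no  y≰2r = let 2r<y = ≰⇒> y≰2r
                           X′ , y′ , s , int′ = step {r} {X} {y} e int
                       in inherit {X} {y} {X′} {y′} s (below n
                            (<-≤-trans (step-decreases 2≤r 2≤X e 2r<y s) (i<j⇒i≤pred[j] X<n+1))
                            (step-equable {r} {X} {y} {X′} {y′} e s) int′
                            (step-≥2 2≤r 2≤X e 2r<y s) (step-≥-2r 2≤r 2≤X e 2r<y s))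

    -- The lower bound on y is one that survives a step (step-≥-2r); y ≥ 0 does not.
    descent : ∀ {X y} → Equable r X y → Integral r X y → + 2 ≤ X → - (+ 2 * r) ≤ y → C X y
    descent {X} e int 2≤X = below (ℕ.suc ∣ X ∣)
      (subst (_< + ℕ.suc ∣ X ∣) (0≤i⇒+∣i∣≡i (≤-trans 0≤+ 2≤X)) (+<+ ℕ.≤-refl)) e int 2≤X

  abs-square : ∀ i → + ∣ i ∣ * + ∣ i ∣ ≡ i * i
  abs-square (+ _)    = refl
  abs-square -[1+ _ ] = refl

  -- Solutions in the strip and the possible values of r

  -- X ≥ 3 in `base-bound` would give 3(3r² - 4) ≤ 8r², that is r² ≤ 12.
  base-X≡2 : ∀ {r X y} → + 4 ≤ r → Equable r X y → + 2 ≤ X → - (+ 2 * r) ≤ y → y ≤ + 2 * r → X ≡ + 2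
  base-X≡2 {r} {X} {y} 4≤r e 2≤X -2r≤y y≤2r with X ≤? + 2
  ... | yes X≤2 = ≤-antisym X≤2 2≤X
  ... | no  X≰2 = ⊥-elim (<⇒≱ (0<-+ {+ 4} 0<+suc (0≤-* (i≤j⇒0≤j-i 4≤r) (0≤-+ (≤-trans 0≤+ 4≤r) (0≤+ {4}))))
    (0≤i-j⇒j≤i (subst (0ℤ ≤_) eq
      (0≤-+ (i≤j⇒0≤j-i (base-bound 2≤r 2≤X {y} e -2r≤y y≤2r))
            (0≤-* (<⇒≤ (0<3r²-4 2≤r 2≤X)) (i≤j⇒0≤j-i {+ 3} (i<j⇒suc[i]≤j (≰⇒> X≰2))))))))
    where
    2≤r = ≤-trans (+≤+ (s≤s (s≤s z≤n))) 4≤r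
    eq : (+ 8 * r * r - (+ 3 * r * r - + 4) * X) + (+ 3 * r * r - + 4) * (X - + 3)
         ≡ 0ℤ - (+ 4 + (r - + 4) * (r + + 4))
    eq = solve (r ∷ X ∷ [])

  -- The one value r > 2 that `base-X≡2` misses. `base-bound` reads 23X ≤ 72, whereas integrality
  -- for odd r makes X a positive multiple of 4.
  base-side₃ : ∀ {X y} → Equable (+ 3) X y → Integral (+ 3) X y → + 2 ≤ X → - + 6 ≤ y → y ≤ + 6 → ⊥
  base-side₃ _ (inj₁ (ρ , eq)) _ _ _ = even≢odd ρ (+ 1) (sym eq)
  base-side₃ {y = y} e (inj₂ (_ , (v , refl) , _)) 2≤X -6≤y y≤6 =
    <⇒≱ 0<v (i<j⇒i≤pred[j] v<1)
    where
    0<v : 0ℤ < v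
    0<v = *-cancelˡ-<-nonNeg {0ℤ} {v} (+ 4) (<-≤-trans 0<+suc 2≤X)
    v<1 : v < + 1
    v<1 = *-cancelˡ-<-nonNeg {v} {+ 1} (+ 92) (≤-<-trans
      (subst (_≤ + 72) eq (base-bound {+ 3} (+≤+ (s≤s (s≤s z≤n))) 2≤X {y} e -6≤y y≤6))
      (+<+ (ℕ.m≤m+n 73 19)))
      where
      eq : + 23 * (+ 4 * v) ≡ + 92 * v
      eq = solve (v ∷ [])

  -- At X = 2 the equation is y² = r² - 12. For r > 4 this lies strictly between (r - 2)² and r²,
  -- hence equals (r - 1)², so 2r = 13.
  base-side≤4 : ∀ {r y} → + 4 ≤ r → Equable r (+ 2) y → r ≡ + 4
  base-side≤4 {r} {y} 4≤r e with r ≤? + 4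
  ... | yes r≤4 = ≤-antisym r≤4 4≤r
  ... | no  r≰4 = ⊥-elim (even≢odd r (+ 6)
    (linear (+ 1) squares (solve (r ∷ []))))
    where
    a = + ∣ y ∣
    e′ : r * r * + 4 ≡ + 4 * (+ 12 + y * y)
    e′ = e
    norm : a * a ≡ r * r - + 12
    norm = trans (abs-square y) (*-cancelˡ-≡ (+ 4) (y * y) (r * r - + 12) (linear (- + 1) e′ (solve (r ∷ y ∷ []))))
    lower : + 3 * (r * r - + 12) - + 3 * ((r - + 2) * (r - + 2)) ≡ + 12 * (r - + 4)
    lower = solve (r ∷ [])
    upper : + 3 * (r * r) - + 3 * (r * r - + 12) ≡ + 36
    upper = solve (r ∷ [])
    r-2<a : r - + 2 < a
    r-2<a = square-reflects-< {r - + 2} {a} {+ 12 * (r - + 4)} 0≤+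
      (0<-* {+ 12} 0<+suc (i<j⇒0<j-i (≰⇒> r≰4)))
      (trans (cong (λ t → + 3 * t - + 3 * ((r - + 2) * (r - + 2))) norm) lower)
    a<r : a < r
    a<r = square-reflects-< {a} {r} {+ 36} (≤-trans 0≤+ 4≤r) 0<+suc
      (trans (cong (λ t → + 3 * (r * r) - + 3 * t) norm) upper)
    r-1 : + 1 + (r - + 2) ≡ - + 1 + r
    r-1 = solve (r ∷ [])
    a≡r-1 : a ≡ - + 1 + r
    a≡r-1 = ≤-antisym (i<j⇒i≤pred[j] a<r) (subst (_≤ a) r-1 (i<j⇒suc[i]≤j r-2<a))
    squares : r * r - + 12 ≡ (- + 1 + r) * (- + 1 + r)
    squares = trans (sym norm) (cong (λ t → t * t) a≡r-1)

  base-side : ∀ {r X y} → + 2 ≤ r → Equable r X y → Integral r X y → + 2 ≤ X →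
              - (+ 2 * r) ≤ y → y ≤ + 2 * r → r ≡ + 2 ⊎ r ≡ + 4
  base-side {+ 0} (+≤+ ())
  base-side {+ 1} (+≤+ (s≤s ()))
  base-side {+ 2} _ _ _ _ _ _ = inj₁ refl
  base-side {+ 3} {X} {y} _ e int 2≤X l h = ⊥-elim (base-side₃ {X} {y} e int 2≤X l h)
  base-side {r@(+ ℕ.suc (ℕ.suc (ℕ.suc (ℕ.suc k))))} {X} {y} _ e _ 2≤X l h =
    inj₂ (base-side≤4 {r} {y} 4≤r (subst (λ X → Equable r X y) (base-X≡2 {r} {X} {y} 4≤r e 2≤X l h) e))
    where
    4≤r : + 4 ≤ r
    4≤r = +≤+ (s≤s (s≤s (s≤s (s≤s z≤n))))

  -2r≤ : ∀ n {y} → 0ℤ ≤ y → - (+ 2 * + n) ≤ y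
  -2r≤ n 0≤y = ≤-trans (neg-mono-≤ (0≤-* {+ 2} {+ n} 0≤+ 0≤+)) 0≤y

  vertical-side : ∀ {r X y} → 0ℤ < r → Equable r X y → Integral r X y → + 2 ≤ X → 0ℤ ≤ y →
                  r ≡ + 2 ⊎ r ≡ + 4
  vertical-side {+ 0} (+<+ ())
  vertical-side {+ 1} {X} {y} _ e _ 2≤X _ = ⊥-elim (<⇒≱
    (0<-+ {+ 32} 0<+suc (0≤-+ (0≤-* {+ 24} 0≤+ (i≤j⇒0≤j-i 2≤X))
       (0≤-+ (0≤-* {+ 3} 0≤+ (0≤-square X)) (0≤-* {+ 4} 0≤+ (0≤-square y)))))
    (≤-reflexive eq))
    where
    e′ : + 1 * ((+ 3 * X - + 4) * (+ 3 * X - + 4)) ≡ + 4 * (+ 3 * (X * X) + y * y)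
    e′ = e
    eq : + 32 + (+ 24 * (X - + 2) + (+ 3 * (X * X) + + 4 * (y * y))) ≡ 0ℤ
    eq = linear (- + 1) e′ (solve (X ∷ y ∷ []))
  vertical-side {r@(+ ℕ.suc (ℕ.suc k))} {X} {y} _ e int 2≤X 0≤y =
    -- A step does not change r, so the claim may be constant in X and y and is inherited trivially.
    descent 2≤r (λ _ _ → r ≡ + 2 ⊎ r ≡ + 4) (λ {X} {y} → base-side {r} {X} {y} 2≤r) (λ _ c → c)
      {X} {y} e int 2≤X (-2r≤ (ℕ.suc (ℕ.suc k)) 0≤y)
    where
    2≤r : + 2 ≤ r
    2≤r = +≤+ (s≤s (s≤s z≤n))

  -- The orbit for r = 2

  -- Multiplication of √3 u + √2 m by the unit 5 + 2√6. Its trace is 10 and its norm 1, which is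
  -- where the second-order recurrence comes from.
  linear-recurrence : ∀ n → u (ℕ.suc n) ≡ + 5 * u n + + 4 * m n × m (ℕ.suc n) ≡ + 6 * u n + + 5 * m n
  linear-recurrence ℕ.zero = refl , refl
  linear-recurrence (ℕ.suc n) with u (ℕ.suc n) | m (ℕ.suc n) | linear-recurrence n
  ... | _ | _ | refl , refl = lemma₁ (u n) (m n) , lemma₂ (u n) (m n)
    where
    lemma₁ : ∀ a b → + 10 * (+ 5 * a + + 4 * b) - a ≡
                     + 5 * (+ 5 * a + + 4 * b) + + 4 * (+ 6 * a + + 5 * b)
    lemma₁ = solve-∀
    lemma₂ : ∀ a b → + 10 * (+ 6 * a + + 5 * b) - b ≡
                     + 6 * (+ 5 * a + + 4 * b) + + 5 * (+ 6 * a + + 5 * b)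
    lemma₂ = solve-∀

  -- The index 0 stands for (4 , - 4), the predecessor of (4 , 4).
  Family₂ : ℤ → ℤ → Set
  Family₂ X y = ∃[ n ] (X ≡ + 2 + + 2 * u n × y ≡ + 4 * m n)

  family₂-step : ∀ {X y X′ y′} → Step (+ 2) X y X′ y′ → Family₂ X′ y′ → Family₂ X y
  family₂-step {X} {y} {X′} {y′} (eX , ey) (n , refl , refl) = ℕ.suc n ,
    trans (inverse₁ (u n) (m n) eX ey) (cong (λ t → + 2 + + 2 * t) (sym (proj₁ (linear-recurrence n)))) ,
    trans (inverse₂ (u n) (m n) eX ey) (cong (+ 4 *_) (sym (proj₂ (linear-recurrence n))))
    where
    module _ (a b : ℤ)
      (eX : + 2 * (+ 2 + + 2 * a) ≡ + 10 * X - + 16 - + 4 * y)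
      (ey : + 4 * (+ 4 * b) ≡ + 20 * y - + 48 * X + + 96) where
      -- The step has determinant one; the cofactors here and below are the entries of the matrix
      -- that undoes it, up to the scaling of the two equations.
      inverse₁ : X ≡ + 2 + + 2 * (+ 5 * a + + 4 * b)
      inverse₁ = *-cancelˡ-≡ (+ 2) X (+ 2 + + 2 * (+ 5 * a + + 4 * b))
        (linear₂ (- + 5) (- + 1) eX ey (solve (X ∷ y ∷ a ∷ b ∷ [])))
      inverse₂ : y ≡ + 4 * (+ 6 * a + + 5 * b)
      inverse₂ = *-cancelˡ-≡ (+ 4) y (+ 4 * (+ 6 * a + + 5 * b))
        (linear₂ (- + 24) (- + 5) eX ey (solve (X ∷ y ∷ a ∷ b ∷ [])))

  family₂-base : ∀ {X y} → Equable (+ 2) X y → Integral (+ 2) X y → + 2 ≤ X →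
                 - + 4 ≤ y → y ≤ + 4 → Family₂ X y
  family₂-base {X} {y} e _ 2≤X -4≤y y≤4 = go 2≤X X≤4 e
    where
    X≤4 : X ≤ + 4
    X≤4 = *-cancelˡ-≤-pos X (+ 4) (+ 8) (base-bound {+ 2} {X} (+≤+ (s≤s (s≤s z≤n))) 2≤X {y} e -4≤y y≤4)
    nonneg-square : ∀ {n} → y * y ≡ -[1+ n ] → ⊥
    nonneg-square eq with () ← subst (0ℤ ≤_) eq (0≤-square y)
    solution : y ≡ + 4 ⊎ y ≡ - + 4 → Family₂ (+ 4) y
    solution (inj₁ eq) = 1 , refl , eq
    solution (inj₂ eq) = 0 , refl , eq
    go : ∀ {X} → + 2 ≤ X → X ≤ + 4 → Equable (+ 2) X y → Family₂ X y
    go {+ 0} (+≤+ ())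
    go {+ 1} (+≤+ (s≤s ()))
    go {+ 2} _ _ e = ⊥-elim (nonneg-square {7} (*-cancelˡ-≡ (+ 4) (y * y) -[1+ 7 ] (linear (- + 1) e′ (solve (y ∷ [])))))
      where
      e′ : + 16 ≡ + 4 * (+ 12 + y * y)
      e′ = e
    go {+ 3} _ _ e = ⊥-elim (nonneg-square {1} (*-cancelˡ-≡ (+ 4) (y * y) -[1+ 1 ] (linear (- + 1) e′ (solve (y ∷ [])))))
      where
      e′ : + 100 ≡ + 4 * (+ 27 + y * y)
      e′ = e
    go {+ 4} _ _ e = solution (square≡⇒≡± {y} {+ 4} (*-cancelˡ-≡ (+ 4) (y * y) (+ 16) (linear (- + 1) e′ (solve (y ∷ [])))))
      where
      e′ : + 256 ≡ + 4 * (+ 48 + y * y)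
      e′ = e
    go {+ ℕ.suc (ℕ.suc (ℕ.suc (ℕ.suc (ℕ.suc _))))} _ (+≤+ (s≤s (s≤s (s≤s (s≤s ())))))

  solutions₂ : ∀ {X y} → Equable (+ 2) X y → + 2 ≤ X → 0ℤ ≤ y →
               ∃[ n ] (X ≡ + 2 + + 2 * u (ℕ.suc n) × y ≡ + 4 * m (ℕ.suc n))
  solutions₂ {X} {y} e 2≤X 0≤y = positive-index
    (descent {r = + 2} (+≤+ ℕ.≤-refl) Family₂ (λ {X} {y} → family₂-base {X} {y})
      (λ {X} {y} {X′} {y′} → family₂-step {X} {y} {X′} {y′}) {X} {y} e (inj₁ (+ 1 , refl)) 2≤X (-2r≤ 2 0≤y))
    where
    positive-index : Family₂ X y → ∃[ n ] (X ≡ + 2 + + 2 * u (ℕ.suc n) × y ≡ + 4 * m (ℕ.suc n))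
    positive-index (ℕ.suc n , eqs)   = n , eqs
    positive-index (ℕ.zero , _ , eq) with () ← subst (0ℤ ≤_) eq 0≤y

  -- The orbits for r = 4

  InFamily₄ : ℤ × ℤ → ℤ → ℤ → Set
  InFamily₄ s X y = ∃[ n ] let (w , v) = wy s (ℕ.suc n) in X ≡ + 4 * w + + 2 × y ≡ + 2 * v

  -- In the coordinates X = 4w + 2, y = 2v, the first alternative consists of the solutions w = 0, v
  -- = ± 1 of 132w² + 36w + 1 = v². They start the two orbits but are not members of the families,
  -- where w > 0.
  Family₄ : ℤ → ℤ → Set
  Family₄ X y = (X ≡ + 2 × (y ≡ + 2 ⊎ y ≡ - + 2))
              ⊎ (InFamily₄ (+ 1 , + 13) X y ⊎ InFamily₄ (+ 5 , + 59) X y)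

  family₄-step : ∀ {X y X′ y′} → Step (+ 4) X y X′ y′ → Family₄ X′ y′ → Family₄ X y
  family₄-step {X} {y} {X′} {y′} (eX , ey) = go
    where
    eX′ : + 2 * X′ ≡ + 46 * X - + 64 - + 8 * y
    eX′ = eX
    ey′ : + 4 * y′ ≡ + 92 * y - + 528 * X + + 768
    ey′ = ey
    inverse₁ : X ≡ + 23 * X′ - + 32 + + 4 * y′
    inverse₁ = *-cancelˡ-≡ (+ 2) X (+ 23 * X′ - + 32 + + 4 * y′)
      (linear₂ (- + 23) (- + 2) eX′ ey′ (solve (X ∷ y ∷ X′ ∷ y′ ∷ [])))
    inverse₂ : y ≡ + 23 * y′ + + 132 * X′ - + 192
    inverse₂ = *-cancelˡ-≡ (+ 4) y (+ 23 * y′ + + 132 * X′ - + 192)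
      (linear₂ (- + 264) (- + 23) eX′ ey′ (solve (X ∷ y ∷ X′ ∷ y′ ∷ [])))
    values : ∀ {a b} → X′ ≡ a → y′ ≡ b →
             X ≡ + 23 * a - + 32 + + 4 * b × y ≡ + 23 * b + + 132 * a - + 192
    values refl refl = inverse₁ , inverse₂
    next : ∀ s → InFamily₄ s X′ y′ → InFamily₄ s X y
    next s (n , p , q) = let (w , v) = wy s (ℕ.suc n)
                             (eX , ey) = values p q in
      ℕ.suc n , trans eX (lemma₁ w v) , trans ey (lemma₂ w v)
      where
      lemma₁ : ∀ w v → + 23 * (+ 4 * w + + 2) - + 32 + + 4 * (+ 2 * v) ≡
                       + 4 * (+ 23 * w + + 2 * v + + 3) + + 2
      lemma₁ = solve-∀
      lemma₂ : ∀ w v → + 23 * (+ 2 * v) + + 132 * (+ 4 * w + + 2) - + 192 ≡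
                       + 2 * (+ 264 * w + + 23 * v + + 36)
      lemma₂ = solve-∀
    go : Family₄ X′ y′ → Family₄ X y
    -- The unit carries (2 , 2) to (22 , 118), where w = 5 and v = 59, and (2 , - 2) to (6 , 26),
    -- where w = 1 and v = 13.
    go (inj₁ (p , inj₁ q)) = inj₂ (inj₂ (0 , values p q))
    go (inj₁ (p , inj₂ q)) = inj₂ (inj₁ (0 , values p q))
    go (inj₂ (inj₁ f)) = inj₂ (inj₁ (next _ f))
    go (inj₂ (inj₂ f)) = inj₂ (inj₂ (next _ f))

  family₄-base : ∀ {X y} → Equable (+ 4) X y → Integral (+ 4) X y → + 2 ≤ X →
                 - + 8 ≤ y → y ≤ + 8 → Family₄ X y
  family₄-base {X} {y} e _ 2≤X -8≤y y≤8 =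
    inj₁ (X≡2 , square≡⇒≡± {y} {+ 2} (*-cancelˡ-≡ (+ 4) (y * y) (+ 4) (linear (- + 1) e′ (solve (y ∷ [])))))
    where
    X≡2 : X ≡ + 2
    X≡2 = base-X≡2 {+ 4} {X} {y} ≤-refl e 2≤X -8≤y y≤8
    e′ : + 64 ≡ + 4 * (+ 12 + y * y)
    e′ = subst (λ X → Equable (+ 4) X y) X≡2 e

  solutions₄ : ∀ {X y} → Equable (+ 4) X y → + 2 ≤ X → 0ℤ ≤ y →
               (X ≡ + 2 × y ≡ + 2) ⊎ (InFamily₄ (+ 1 , + 13) X y ⊎ InFamily₄ (+ 5 , + 59) X y)
  solutions₄ {X} {y} e 2≤X 0≤y = positive-index
    (descent {r = + 4} (+≤+ (s≤s (s≤s z≤n))) Family₄ (λ {X} {y} → family₄-base {X} {y})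
      (λ {X} {y} {X′} {y′} → family₄-step {X} {y} {X′} {y′}) {X} {y} e (inj₁ (+ 2 , refl)) 2≤X (-2r≤ 4 0≤y))
    where
    positive-index : Family₄ X y → (X ≡ + 2 × y ≡ + 2) ⊎ (InFamily₄ (+ 1 , + 13) X y ⊎ InFamily₄ (+ 5 , + 59) X y)
    positive-index (inj₁ (p , inj₁ q)) = inj₁ (p , q)
    positive-index (inj₁ (_ , inj₂ q)) with () ← subst (0ℤ ≤_) q 0≤y
    positive-index (inj₂ f)            = inj₂ f

  -- Rational square roots are integral

  -- Divide by the gcd h: the cofactor a′ still divides b′b′ and is coprime to b′, so a′ = 1 and a =
  -- h.
  square-∣⇒∣ : ∀ a b .{{_ : ℕ.NonZero a}} → a ℕ.* a ℕ.∣ b ℕ.* b → a ℕ.∣ b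
  square-∣⇒∣ a b aa∣bb = subst (ℕ._∣ b) h≡a (gcd[m,n]∣n a b)
    where
    h = gcd a b
    instance
      h≢0 : ℕ.NonZero h
      h≢0 = ℕ.≢-nonZero (gcd[m,n]≢0 a b (inj₁ (ℕ.≢-nonZero⁻¹ a)))
      hh≢0 : ℕ.NonZero (h ℕ.* h)
      hh≢0 = ℕ.m*n≢0 h h
    a′ = a ℕ./ h
    b′ = b ℕ./ h
    a≡ : a ≡ a′ ℕ.* h
    a≡ = sym (m/n*n≡m (gcd[m,n]∣m a b))
    b≡ : b ≡ b′ ℕ.* h
    b≡ = sym (m/n*n≡m (gcd[m,n]∣n a b))
    coprime : Coprime a′ b′
    coprime = coprime-/gcd a b
    a′a′∣b′b′ : a′ ℕ.* a′ ℕ.∣ b′ ℕ.* b′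
    a′a′∣b′b′ = ℕ.*-cancelʳ-∣ (h ℕ.* h)
      (subst₂ ℕ._∣_ (trans (cong₂ ℕ._*_ a≡ a≡) (ℕ.[m*n]*[o*p]≡[m*o]*[n*p] a′ h a′ h)) (trans (cong₂ ℕ._*_ b≡ b≡) (ℕ.[m*n]*[o*p]≡[m*o]*[n*p] b′ h b′ h)) aa∣bb)
    a′∣b′ : a′ ℕ.∣ b′
    a′∣b′ = coprime-divisor coprime (ℕ.∣-trans (ℕ.m∣m*n a′) a′a′∣b′b′)
    h≡a : h ≡ a
    h≡a = sym (trans a≡ (trans (cong (ℕ._* h) (coprime (ℕ.∣-refl , a′∣b′))) (ℕ.*-identityˡ h)))

  prime[3] : Prime 3
  prime[3] = from-yes (prime? 3)

  ∣-square⇒∣ : ∀ {p} n → Prime p → p ℕ.∣ n ℕ.* n → p ℕ.∣ n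
  ∣-square⇒∣ n p-prime p∣nn = reduce (euclidsLemma n n p-prime p∣nn)

  square-root-of-multiple : ∀ {p} n d h .{{_ : ℕ.NonZero d}} → n ℕ.* (d ℕ.* d) ≡ p ℕ.* p → p ≡ h ℕ.* d →
                            n ≡ h ℕ.* h
  square-root-of-multiple n d h eq refl = ℕ.*-cancelʳ-≡ n (h ℕ.* h) (d ℕ.* d) {{ℕ.m*n≢0 d d}}
    (trans eq (ℕ.[m*n]*[o*p]≡[m*o]*[n*p] h d h d))

  12n-square : ∀ n h → n ℕ.* 12 ≡ h ℕ.* h → ∃[ t ] n ≡ t ℕ.* t ℕ.* 3
  12n-square n h eq
    with ∣-square⇒∣ h prime[2] (subst (2 ℕ.∣_) eq (ℕ.∣-trans (ℕ.divides 6 refl) (ℕ.n∣m*n n)))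
  ... | ℕ.divides k h≡
    with square-root-of-multiple (n ℕ.* 3) 2 k (trans (ℕ.*-assoc n 3 4) eq) h≡
  ... | 3n≡kk with ∣-square⇒∣ k prime[3] (ℕ.divides n (sym 3n≡kk))
  ... | ℕ.divides t refl = t , ℕ.*-cancelʳ-≡ n (t ℕ.* t ℕ.* 3) 3 (begin
    n ℕ.* 3                   ≡⟨ 3n≡kk ⟩
    t ℕ.* 3 ℕ.* (t ℕ.* 3)     ≡⟨ ℕ.[m*n]*[o*p]≡[m*o]*[n*p] t 3 t 3 ⟩
    t ℕ.* t ℕ.* 9             ≡⟨ ℕ.*-assoc (t ℕ.* t) 3 3 ⟨
    t ℕ.* t ℕ.* 3 ℕ.* 3       ∎)
    where open ≡-Reasoning

  rational-root-ℕ : ∀ n d g .{{_ : ℕ.NonZero d}} → n ℕ.* 12 ℕ.* (d ℕ.* d) ≡ g ℕ.* g →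
                    ∃[ t ] n ≡ t ℕ.* t ℕ.* 3
  rational-root-ℕ n d g eq with square-∣⇒∣ d g (ℕ.divides (n ℕ.* 12) (sym eq))
  ... | ℕ.divides h g≡ = 12n-square n h (square-root-of-multiple (n ℕ.* 12) d h eq g≡)

  -- The hypothesis says that 12n is the square of the rational g / d, hence an integral square; its
  -- root is divisible by 2 and then by 3, which leaves n = 3t². Applied to a norm, this makes the
  -- length t√3.
  rational-root : ∀ n d g → 0ℤ ≤ n → d ≢ 0ℤ → n * + 12 * (d * d) ≡ g * g →
                  ∃[ t ] n ≡ + t * + t * + 3
  rational-root (+ n) d g _ d≢0 eq =
    let t , n≡ = rational-root-ℕ n ∣ d ∣ ∣ g ∣ {{ℕ.≢-nonZero (d≢0 ∘ ∣i∣≡0⇒i≡0)}} abs-eq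
    in t , trans (cong +_ n≡) (trans (pos-* (t ℕ.* t) 3) (cong (_* + 3) (pos-* t t)))
    where
    open ≡-Reasoning
    abs-eq : n ℕ.* 12 ℕ.* (∣ d ∣ ℕ.* ∣ d ∣) ≡ ∣ g ∣ ℕ.* ∣ g ∣
    abs-eq = begin
      n ℕ.* 12 ℕ.* (∣ d ∣ ℕ.* ∣ d ∣)  ≡⟨ cong₂ ℕ._*_ (abs-* (+ n) (+ 12)) (abs-* d d) ⟨
      ∣ + n * + 12 ∣ ℕ.* ∣ d * d ∣    ≡⟨ abs-* (+ n * + 12) (d * d) ⟨
      ∣ + n * + 12 * (d * d) ∣        ≡⟨ cong ∣_∣ eq ⟩
      ∣ g * g ∣                       ≡⟨ abs-* g g ⟩
      ∣ g ∣ ℕ.* ∣ g ∣                 ∎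

  3∣square⇒3∣ : ∀ z k → z * z ≡ + 3 * k → ∃[ h ] z ≡ + 3 * h
  3∣square⇒3∣ z k eq with ∣-square⇒∣ ∣ z ∣ prime[3] (ℕ.divides ∣ k ∣
    (trans (sym (abs-* z z)) (trans (cong ∣_∣ eq) (trans (abs-* (+ 3) k) (ℕ.*-comm 3 ∣ k ∣)))))
  ... | ℕ.divides h ∣z∣≡h*3 = go z (trans (cong +_ ∣z∣≡h*3) (trans (pos-* h 3) (*-comm (+ h) (+ 3))))
    where
    go : ∀ z → + ∣ z ∣ ≡ + 3 * + h → ∃[ h ] z ≡ + 3 * h
    go (+ _)    eq = + h , eq
    go -[1+ _ ] eq = - + h , trans (cong -_ eq) (neg-distribʳ-* (+ 3) (+ h))

  -- Pell solutions from sides of length 2√3 and 4√3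

  -- `D` is the absolute value of the determinant and `q` twice the inner product of the two sides.
  -- Only the sign of `q` stays open, since y ≥ 0 is wanted for the descent.
  record SideSolution (r D q : ℤ) : Set where
    field
      X y     : ℤ
      equable : Equable r X y
      2≤X     : + 2 ≤ X
      0≤y     : 0ℤ ≤ y
      D≡      : D ≡ + 3 * r * X
      q≡      : q ≡ + 3 * r * y ⊎ q ≡ - (+ 3 * r * y)

  nonNeg-quotient : ∀ {k s} → 0ℤ ≤ s → s ≡ + 48 * k → 0ℤ ≤ k
  nonNeg-quotient {k} 0≤s eq = *-cancelˡ-≤-pos 0ℤ k (+ 48) (subst (0ℤ ≤_) eq 0≤s)

  -- With s = r + t, Lagrange's identity takes this form for r = 2, and for r = 4 with 2t in the
  -- place of t. Then 12(3t² - s²) is a rational square, so 3t² - s² = 3e²; reduction modulo 3 gives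
  -- 3 ∣ s. These are the divisibilities behind X and y.
  gram-roots : ∀ {ℓ} (C : Set ℓ) (s t q : ℤ) →
    q * q ≡ + 48 * (+ 3 * (t * t) - s * s) →
    (∀ e h → + 3 * (t * t) - s * s ≡ + e * + e * + 3 → s ≡ + 3 * h → C) → C
  gram-roots C s t q eq f =
    let e , k≡ = rational-root (+ 3 * (t * t) - s * s) (+ 2) q
          (nonNeg-quotient (0≤-square q) eq) (λ ()) (trans (regroup (+ 3 * (t * t) - s * s)) (sym eq))
        h , s≡ = 3∣square⇒3∣ s (t * t - + e * + e) (third (+ e) k≡)
    in f e h k≡ s≡
    where
    regroup : ∀ k → k * + 12 * + 4 ≡ + 48 * k
    regroup = solve-∀
    third : ∀ e → + 3 * (t * t) - s * s ≡ e * e * + 3 → s * s ≡ + 3 * (t * t - e * e)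
    third e k≡ = linear (- + 1) k≡ (solve (s ∷ t ∷ e ∷ []))

  sideSolution₂ : ∀ t q → 0ℤ ≤ t →
                  q * q + + 3 * ((+ 4 * (+ 2 + t)) * (+ 4 * (+ 2 + t))) ≡ + 144 * (t * t) →
                  SideSolution (+ 2) (+ 4 * (+ 2 + t)) q
  sideSolution₂ t q 0≤t eq = gram-roots _ (+ 2 + t) t q
    (linear (+ 1) eq (solve (q ∷ t ∷ []))) λ e h → solution h (+ e) 0≤+
    where
    solution : ∀ h e → 0ℤ ≤ e → + 3 * (t * t) - (+ 2 + t) * (+ 2 + t) ≡ e * e * + 3 →
               + 2 + t ≡ + 3 * h → SideSolution (+ 2) (+ 4 * (+ 2 + t)) q
    solution h e 0≤e k≡ s≡ = record
      -- D = 4s = 12h and q² = 48 · 3e² = (12e)²; both are divided by 3r = 6.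
      { X       = + 2 * h
      ; y       = + 2 * e
      ; equable = equable
      ; 2≤X     = *-monoˡ-≤-nonNeg (+ 2) (i<j⇒suc[i]≤j (*-cancelˡ-<-nonNeg {0ℤ} {h} (+ 3)
                    (subst (0ℤ <_) s≡ (0<-+ {+ 2} 0<+suc 0≤t))))
      ; 0≤y     = 0≤-* {+ 2} 0≤+ 0≤e
      ; D≡      = D≡
      ; q≡      = square≡⇒≡± {q} {+ 6 * (+ 2 * e)} square
      }
      where
      equable : + 4 * ((+ 3 * (+ 2 * h) - + 4) * (+ 3 * (+ 2 * h) - + 4)) ≡
                + 4 * (+ 3 * ((+ 2 * h) * (+ 2 * h)) + (+ 2 * e) * (+ 2 * e))
      equable = *-cancelˡ-≡ (+ 3)
        (+ 4 * ((+ 3 * (+ 2 * h) - + 4) * (+ 3 * (+ 2 * h) - + 4)))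
        (+ 4 * (+ 3 * ((+ 2 * h) * (+ 2 * h)) + (+ 2 * e) * (+ 2 * e)))
        (linear₂ (+ 16) (+ 192 - + 32 * (+ 2 + t + + 3 * h)) k≡ s≡ (solve (t ∷ h ∷ e ∷ [])))
      D≡ : + 4 * (+ 2 + t) ≡ + 6 * (+ 2 * h)
      D≡ = linear (+ 4) s≡ (solve (t ∷ h ∷ []))
      square : q * q ≡ + 6 * (+ 2 * e) * (+ 6 * (+ 2 * e))
      square = linear₂ (+ 1) (+ 48) eq k≡ (solve (q ∷ t ∷ e ∷ []))

  sideSolution₄ : ∀ t q → 0ℤ ≤ t →
                  q * q + + 3 * ((+ 4 * (+ 4 + t)) * (+ 4 * (+ 4 + t))) ≡ + 576 * (t * t) →
                  SideSolution (+ 4) (+ 4 * (+ 4 + t)) q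
  -- Here 576t² = 48 · 3(2t)². Again D = 12h and q = ± 12e, but now 3r = 12, so X = h and y = e.
  sideSolution₄ t q 0≤t eq = gram-roots _ (+ 4 + t) (+ 2 * t) q
    (linear (+ 1) eq (solve (q ∷ t ∷ []))) λ e h → solution h (+ e) 0≤+
    where
    solution : ∀ h e → 0ℤ ≤ e →
               + 3 * ((+ 2 * t) * (+ 2 * t)) - (+ 4 + t) * (+ 4 + t) ≡ e * e * + 3 →
               + 4 + t ≡ + 3 * h → SideSolution (+ 4) (+ 4 * (+ 4 + t)) q
    solution h e 0≤e k≡ s≡ = record
      { X       = h
      ; y       = e
      ; equable = equable
      ; 2≤X     = i<j⇒suc[i]≤j (*-cancelˡ-<-nonNeg {+ 1} {h} (+ 3)
                    (subst (+ 3 <_) s≡ (<-≤-trans (+<+ ℕ.≤-refl) (4≤4+j 0≤t))))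
      ; 0≤y     = 0≤e
      ; D≡      = D≡
      ; q≡      = square≡⇒≡± {q} {+ 12 * e} square
      }
      where
      4≤4+j : ∀ {j} → 0ℤ ≤ j → + 4 ≤ + 4 + j
      4≤4+j = +-monoʳ-≤ (+ 4)
      equable : + 16 * ((+ 3 * h - + 4) * (+ 3 * h - + 4)) ≡ + 4 * (+ 3 * (h * h) + e * e)
      equable = *-cancelˡ-≡ (+ 3)
        (+ 16 * ((+ 3 * h - + 4) * (+ 3 * h - + 4)))
        (+ 4 * (+ 3 * (h * h) + e * e))
        (linear₂ (+ 4) (+ 384 - + 44 * (+ 4 + t + + 3 * h)) k≡ s≡ (solve (t ∷ h ∷ e ∷ [])))
      D≡ : + 4 * (+ 4 + t) ≡ + 12 * h
      D≡ = linear (+ 4) s≡ (solve (t ∷ h ∷ []))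
      square : q * q ≡ + 12 * e * (+ 12 * e)
      square = linear₂ (+ 1) (+ 48) eq k≡ (solve (q ∷ t ∷ e ∷ []))

  abs-≡ : ∀ {a b} → 0ℤ ≤ b → a ≡ b ⊎ a ≡ - b → + ∣ a ∣ ≡ b
  abs-≡ 0≤b (inj₁ refl)         = 0≤i⇒+∣i∣≡i 0≤b
  abs-≡ {b = b} 0≤b (inj₂ refl) = trans (cong +_ (∣-i∣≡∣i∣ b)) (0≤i⇒+∣i∣≡i 0≤b)

  -- Vertical sides of arbitrary length

  module _ {r X y t : ℤ} (eX : + 3 * r * X ≡ + 4 * (r + t)) (ey : + 3 * (X * X) + y * y ≡ + 4 * (t * t)) where

    vertical-equable : Equable r X y
    vertical-equable = linear₂ (r * (+ 3 * X - + 4) + + 4 * t) (- + 4) eX ey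
      (solve (r ∷ X ∷ y ∷ t ∷ []))

    private
      eq : + 3 * r * (+ 1 - X) + + 4 * t ≡ 0ℤ - r
      eq = linear (- + 1) eX (solve (r ∷ X ∷ t ∷ []))

    vertical-2≤X : 0ℤ < r → 0ℤ ≤ t → + 2 ≤ X
    vertical-2≤X 0<r 0≤t with + 2 ≤? X
    ... | yes 2≤X = 2≤X
    ... | no  2≰X = ⊥-elim (<⇒≱ 0<r (0≤i-j⇒j≤i (subst (0ℤ ≤_) eq
        (0≤-+ (0≤-* {+ 3 * r} (0≤-* {+ 3} 0≤+ (<⇒≤ 0<r)) (i≤j⇒0≤j-i (i<j⇒i≤pred[j] (≰⇒> 2≰X)))) (0≤-* {+ 4} 0≤+ 0≤t)))))

  vertical-integral : ∀ r X y t → + 3 * r * X ≡ + 4 * (r + t) → + 3 * (X * X) + y * y ≡ + 4 * (t * t) →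
                      Integral r X y
  vertical-integral r X y t eX ey with even⊎odd r
  ... | inj₁ even         = inj₁ even
  ... | inj₂ (σ , r≡) = halve (even⊎odd X)
    where
    eX′ : + 3 * (+ 1 + + 2 * σ) * X ≡ + 4 * ((+ 1 + + 2 * σ) + t)
    eX′ = subst (λ r → + 3 * r * X ≡ + 4 * (r + t)) r≡ eX
    Goal : Set
    Goal = Integral r X y
    module _ (v : ℤ) (X≡ : X ≡ + 4 * v) where
      ey′ : + 3 * ((+ 4 * v) * (+ 4 * v)) + y * y ≡ + 4 * (t * t)
      ey′ = subst (λ X → + 3 * (X * X) + y * y ≡ + 4 * (t * t)) X≡ ey
      halve-y : (∃[ p ] y ≡ + 2 * p) ⊎ (∃[ p ] y ≡ + 1 + + 2 * p) → Goal
      halve-y (inj₁ p)        = inj₂ ((σ , r≡) , (v , X≡) , p)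
      halve-y (inj₂ (p , y≡)) = ⊥-elim (even≢odd (+ 2 * (t * t) - + 24 * (v * v)) (+ 2 * (p * p) + + 2 * p)
        (linear (- + 1) ey″ (solve (v ∷ t ∷ p ∷ []))))
        where
        ey″ : + 3 * ((+ 4 * v) * (+ 4 * v)) + (+ 1 + + 2 * p) * (+ 1 + + 2 * p) ≡ + 4 * (t * t)
        ey″ = subst (λ y → + 3 * ((+ 4 * v) * (+ 4 * v)) + y * y ≡ + 4 * (t * t)) y≡ ey′
    module _ (ξ : ℤ) (X≡ : X ≡ + 2 * ξ) where
      eX″ : + 3 * (+ 1 + + 2 * σ) * (+ 2 * ξ) ≡ + 4 * ((+ 1 + + 2 * σ) + t)
      eX″ = subst (λ X → + 3 * (+ 1 + + 2 * σ) * X ≡ + 4 * ((+ 1 + + 2 * σ) + t)) X≡ eX′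
      halve-ξ : (∃[ v ] ξ ≡ + 2 * v) ⊎ (∃[ v ] ξ ≡ + 1 + + 2 * v) → Goal
      halve-ξ (inj₁ (v , ξ≡)) = halve-y v
        (trans X≡ (trans (cong (+ 2 *_) ξ≡) (sym (*-assoc (+ 2) (+ 2) v)))) (even⊎odd y)
      halve-ξ (inj₂ (v , ξ≡)) = ⊥-elim (even≢odd (+ 1 + + 2 * σ + t) (+ 1 + + 3 * σ + + 3 * v + + 6 * σ * v)
        (*-cancelˡ-≡ (+ 2) (+ 2 * (+ 1 + + 2 * σ + t)) (+ 1 + + 2 * (+ 1 + + 3 * σ + + 3 * v + + 6 * σ * v))
          (linear (- + 1) eX‴ (solve (σ ∷ t ∷ v ∷ [])))))
        where
        eX‴ : + 3 * (+ 1 + + 2 * σ) * (+ 2 * (+ 1 + + 2 * v)) ≡ + 4 * ((+ 1 + + 2 * σ) + t)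
        eX‴ = subst (λ ξ → + 3 * (+ 1 + + 2 * σ) * (+ 2 * ξ) ≡ + 4 * ((+ 1 + + 2 * σ) + t)) ξ≡ eX″
    halve : (∃[ ξ ] X ≡ + 2 * ξ) ⊎ (∃[ ξ ] X ≡ + 1 + + 2 * ξ) → Goal
    halve (inj₁ (ξ , X≡)) = halve-ξ ξ X≡ (even⊎odd ξ)
    halve (inj₂ (ξ , X≡)) = ⊥-elim (even≢odd (+ 2 * (+ 1 + + 2 * σ + t)) (+ 1 + + 3 * σ + + 3 * ξ + + 6 * σ * ξ)
      (linear (- + 1) eX‴ (solve (σ ∷ t ∷ ξ ∷ []))))
      where
      eX‴ : + 3 * (+ 1 + + 2 * σ) * (+ 1 + + 2 * ξ) ≡ + 4 * ((+ 1 + + 2 * σ) + t)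
      eX‴ = subst (λ X → + 3 * (+ 1 + + 2 * σ) * X ≡ + 4 * ((+ 1 + + 2 * σ) + t)) X≡ eX′

  -- With b = 2a the side a + bω is vertical of length ∣ a ∣√3.
  vertical-side-length : ∀ a c d t → let r = + ∣ a ∣ in
    0ℤ ≤ t → 0ℤ < r + t → c * c - c * d + d * d ≡ t * t * + 3 →
    (a * d - + 2 * a * c ≡ + 4 * (r + t)) ⊎ (a * d - + 2 * a * c ≡ - (+ 4 * (r + t))) →
    r ≡ + 2 ⊎ r ≡ + 4
  vertical-side-length a c d t 0≤t 0<r+t norm det =
    vertical-side {+ ∣ a ∣} {X} {y} 0<r
      (vertical-equable {+ ∣ a ∣} {X} {y} {t} eX ey) (vertical-integral (+ ∣ a ∣) X y t eX ey)
      (vertical-2≤X {+ ∣ a ∣} {X} {y} {t} eX ey 0<r 0≤t) 0≤+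
    where
    -- Four times the norm of c + dω is (d - 2c)² + 3d², so 3 divides d - 2c = 3h. The determinant
    -- is then 3ah and twice the inner product is 3ad, whence X = ∣ h ∣ and y = ∣ d ∣.
    third = 3∣square⇒3∣ (d - + 2 * c) (+ 4 * (t * t) - d * d) (linear (+ 4) norm (solve (c ∷ d ∷ t ∷ [])))
    h = proj₁ third
    X = + ∣ h ∣
    y = + ∣ d ∣
    0≤r+t : 0ℤ ≤ + 4 * (+ ∣ a ∣ + t)
    0≤r+t = 0≤-* {+ 4} 0≤+ (<⇒≤ 0<r+t)
    eX : + 3 * + ∣ a ∣ * X ≡ + 4 * (+ ∣ a ∣ + t)
    eX = begin
      + 3 * + ∣ a ∣ * X       ≡⟨ regroup (+ ∣ a ∣) X ⟩
      + ∣ a ∣ * (+ 3 * X)     ≡⟨ cong (+ ∣ a ∣ *_) (trans (sym (pos-* 3 ∣ h ∣)) (cong +_ (sym (abs-* (+ 3) h)))) ⟩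
      + ∣ a ∣ * + ∣ + 3 * h ∣ ≡⟨ trans (sym (pos-* ∣ a ∣ ∣ + 3 * h ∣)) (cong +_ (sym (abs-* a (+ 3 * h)))) ⟩
      + ∣ a * (+ 3 * h) ∣     ≡⟨ cong (λ z → + ∣ a * z ∣) (proj₂ third) ⟨
      + ∣ a * (d - + 2 * c) ∣ ≡⟨ cong (λ z → + ∣ z ∣) (expand a c d) ⟩
      + ∣ a * d - + 2 * a * c ∣ ≡⟨ abs-≡ 0≤r+t det ⟩
      + 4 * (+ ∣ a ∣ + t)     ∎
      where
      open ≡-Reasoning
      regroup : ∀ r X → + 3 * r * X ≡ r * (+ 3 * X)
      regroup = solve-∀
      expand : ∀ a c d → a * (d - + 2 * c) ≡ a * d - + 2 * a * c
      expand = solve-∀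
    ey : + 3 * (X * X) + y * y ≡ + 4 * (t * t)
    ey = trans (cong₂ (λ x z → + 3 * x + z) (abs-square h) (abs-square d)) (lemma h (proj₂ third))
      where
      lemma : ∀ h → d - + 2 * c ≡ + 3 * h → + 3 * (h * h) + d * d ≡ + 4 * (t * t)
      lemma h eq = *-cancelˡ-≡ (+ 3) (+ 3 * (h * h) + d * d) (+ 4 * (t * t))
        (linear₂ (- (d - + 2 * c + + 3 * h)) (+ 4) eq norm (solve (c ∷ d ∷ t ∷ h ∷ [])))
    0<r : 0ℤ < + ∣ a ∣
    0<r = ≤∧≢⇒< 0≤+ λ 0≡r → <-irrefl refl (subst (0ℤ <_)
      (trans (sym eX) (cong (λ r → + 3 * r * X) (sym 0≡r))) (0<-* {+ 4} 0<+suc 0<r+t))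

open import Level using (Level; _⊔_)
open import Algebra.Bundles using (CommutativeRing)
import Algebra.Apartness.Properties.HeytingCommutativeRing as Apartness
import Algebra.Properties.Ring as RingProperties
import Algebra.Properties.Semiring.Exp as Exponentiation
import Algebra.Properties.Semiring.Mult as Multiples
import Algebra.Solver.Ring as RingSolver
open import Algebra.Solver.Ring.AlmostCommutativeRing
  using (fromCommutativeRing; _-Raw-AlmostCommutative⟶_)
open import Data.Fin.Base using (Fin)
open import Data.Fin.Patterns using (0F; 1F; 2F; 3F)
open import Data.Integer.Base as ℤ using (ℤ; +_; -[1+_])
import Data.Integer.Properties as ℤ
import Data.Integer.Tactic.RingSolver as ℤ-Solver
import Data.List.Base as List
open import Data.Maybe.Base using (Maybe; just; nothing)
open import Data.Nat.Base as ℕ using (ℕ)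
import Data.Nat.Properties as ℕ
open import Data.Vec.Base using (Vec; []; _∷_; lookup; map)
open import Data.Vec.Properties using (lookup-map)
open import Function.Bundles using (Equivalence)
import Relation.Binary.Reasoning.Setoid as SetoidReasoning
open import Relation.Binary.PropositionalEquality as ≡ using (_≡_; _≢_)

open Integers using (0≤-+; 0<-+; 0≤-*; 0<-*; 0≤+; 0<+suc; 0≤-square; abs-square; abs-≡; square≡⇒≡±;
  linear-recurrence; InFamily₄; solutions₂; solutions₄; rational-root;
  SideSolution; sideSolution₂; sideSolution₄; vertical-side-length)

-- Integers, order and square roots in the real field

module RealField {c ℓ₁ ℓ₂ : Level} (ℝ : Reals c ℓ₁ ℓ₂) where
  open Reals ℝ
  open CommutativeRing commutativeRing using (ring; semiring)
  open RingProperties ring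
    using (-0#≈0#; -‿involutive; -‿distribˡ-*; -‿distribʳ-*; -‿+-comm)
  open Multiples semiring using (×-homo-+; ×1-homo-*)
  open Exponentiation semiring using (_^_; ^-congˡ)
  open Apartness heytingCommutativeRing using (invertibleˡ⇒#; x-0≈x)
  open SetoidReasoning setoid

  private
    variable
      x y z a b a′ b′ l r : Carrier

  fromℤ-⊖ : ∀ m n → fromℤ (m ℤ.⊖ n) ≈ m · 1# - n · 1#
  fromℤ-⊖ m ℕ.zero = sym (x-0≈x (m · 1#))
  fromℤ-⊖ ℕ.zero (ℕ.suc n) = sym (+-identityˡ _)
  fromℤ-⊖ (ℕ.suc m) (ℕ.suc n) = begin
    fromℤ (ℕ.suc m ℤ.⊖ ℕ.suc n)          ≡⟨ ≡.cong fromℤ (ℤ.[1+m]⊖[1+n]≡m⊖n m n) ⟩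
    fromℤ (m ℤ.⊖ n)                      ≈⟨ fromℤ-⊖ m n ⟩
    m · 1# - n · 1#                      ≈⟨ +-congʳ (+-identityʳ _) ⟨
    m · 1# + 0# - n · 1#                 ≈⟨ +-congʳ (+-congˡ (-‿inverseʳ 1#)) ⟨
    m · 1# + (1# - 1#) - n · 1#          ≈⟨ +-congʳ (+-assoc _ _ _) ⟨
    m · 1# + 1# - 1# - n · 1#            ≈⟨ +-assoc _ _ _ ⟩
    m · 1# + 1# + (- 1# - n · 1#)        ≈⟨ +-cong (+-comm _ _) (-‿+-comm _ _) ⟩
    1# + m · 1# - (1# + n · 1#)          ∎

  fromℤ-neg : ∀ i → fromℤ (ℤ.- i) ≈ - fromℤ i
  fromℤ-neg (+ ℕ.zero)  = sym -0#≈0#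
  fromℤ-neg (+ ℕ.suc n) = refl
  fromℤ-neg -[1+ n ]    = sym (-‿involutive _)

  fromℤ-+ : ∀ i j → fromℤ (i ℤ.+ j) ≈ fromℤ i + fromℤ j
  fromℤ-+ (+ m)    (+ n)    = ×-homo-+ 1# m n
  fromℤ-+ (+ m)    -[1+ n ] = fromℤ-⊖ m (ℕ.suc n)
  fromℤ-+ -[1+ m ] (+ n)    = trans (fromℤ-⊖ n (ℕ.suc m)) (+-comm _ _)
  fromℤ-+ -[1+ m ] -[1+ n ] = begin
    - (ℕ.suc (ℕ.suc (m ℕ.+ n)) · 1#)     ≡⟨ ≡.cong (λ k → - (ℕ.suc k · 1#)) (≡.sym (ℕ.+-suc m n)) ⟩
    - ((ℕ.suc m ℕ.+ ℕ.suc n) · 1#)       ≈⟨ -‿cong (×-homo-+ 1# (ℕ.suc m) (ℕ.suc n)) ⟩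
    - (ℕ.suc m · 1# + ℕ.suc n · 1#)      ≈⟨ -‿+-comm _ _ ⟨
    - (ℕ.suc m · 1#) - ℕ.suc n · 1#      ∎

  private
    fromℤ-*⁺ : ∀ m j → fromℤ (+ m ℤ.* j) ≈ m · 1# * fromℤ j
    fromℤ-*⁺ m (+ n) = begin
      fromℤ (+ m ℤ.* + n)     ≡⟨ ≡.cong fromℤ (ℤ.pos-* m n) ⟨
      (m ℕ.* n) · 1#          ≈⟨ ×1-homo-* m n ⟩
      m · 1# * (n · 1#)       ∎
    fromℤ-*⁺ m -[1+ n ] = begin
      fromℤ (+ m ℤ.* -[1+ n ])        ≡⟨ ≡.cong fromℤ (ℤ.neg-distribʳ-* (+ m) (+ ℕ.suc n)) ⟨
      fromℤ (ℤ.- (+ m ℤ.* + ℕ.suc n)) ≈⟨ fromℤ-neg (+ m ℤ.* + ℕ.suc n) ⟩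
      - fromℤ (+ m ℤ.* + ℕ.suc n)     ≈⟨ -‿cong (fromℤ-*⁺ m (+ ℕ.suc n)) ⟩
      - (m · 1# * (ℕ.suc n · 1#))     ≈⟨ -‿distribʳ-* _ _ ⟩
      m · 1# * - (ℕ.suc n · 1#)       ∎

  fromℤ-* : ∀ i j → fromℤ (i ℤ.* j) ≈ fromℤ i * fromℤ j
  fromℤ-* (+ m)    j = fromℤ-*⁺ m j
  fromℤ-* -[1+ m ] j = begin
    fromℤ (-[1+ m ] ℤ.* j)          ≡⟨ ≡.cong fromℤ (ℤ.neg-distribˡ-* (+ ℕ.suc m) j) ⟨
    fromℤ (ℤ.- (+ ℕ.suc m ℤ.* j))   ≈⟨ fromℤ-neg (+ ℕ.suc m ℤ.* j) ⟩
    - fromℤ (+ ℕ.suc m ℤ.* j)       ≈⟨ -‿cong (fromℤ-*⁺ (ℕ.suc m) j) ⟩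
    - (ℕ.suc m · 1# * fromℤ j)      ≈⟨ -‿distribˡ-* _ _ ⟩
    - (ℕ.suc m · 1#) * fromℤ j      ∎

  fromℤ-homomorphism : ℤ.+-*-rawRing -Raw-AlmostCommutative⟶ fromCommutativeRing commutativeRing
  fromℤ-homomorphism = record
    { ⟦_⟧    = fromℤ
    ; +-homo = fromℤ-+
    ; *-homo = fromℤ-*
    ; -‿homo = fromℤ-neg
    ; 0-homo = refl
    ; 1-homo = +-identityʳ 1#
    }

  private
    coefficient-≟ : ∀ i j → Maybe (fromℤ i ≈ fromℤ j)
    coefficient-≟ i j with i ℤ.≟ j
    ... | yes i≡j = just (reflexive (≡.cong fromℤ i≡j))
    ... | no  _   = nothing

  open RingSolver ℤ.+-*-rawRing (fromCommutativeRing commutativeRing) fromℤ-homomorphism coefficient-≟ public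
    using (Polynomial; op; con; var; _:^_; :-_; [+]; [*]; ⟦_⟧; solve; _:=_; _:+_; _:*_; _:-_)

  evalℤ : ∀ {n} → Polynomial n → Vec ℤ n → ℤ
  evalℤ (op [+] p q) ρ = evalℤ p ρ ℤ.+ evalℤ q ρ
  evalℤ (op [*] p q) ρ = evalℤ p ρ ℤ.* evalℤ q ρ
  evalℤ (con i)      ρ = i
  evalℤ (var i)      ρ = lookup ρ i
  evalℤ (p :^ n)     ρ = evalℤ p ρ ℤ.^ n
  evalℤ (:- p)       ρ = ℤ.- evalℤ p ρ

  -- Transfers whole polynomial expressions from ℤ to the reals at once: the solver's syntax tree is
  -- evaluated on both sides instead of rewriting by the homomorphism laws one operation at a time.
  fromℤ-eval : ∀ {n} (p : Polynomial n) (ρ : Vec ℤ n) → fromℤ (evalℤ p ρ) ≈ ⟦ p ⟧ (map fromℤ ρ)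
  fromℤ-eval (op [+] p q) ρ = trans (fromℤ-+ (evalℤ p ρ) (evalℤ q ρ)) (+-cong (fromℤ-eval p ρ) (fromℤ-eval q ρ))
  fromℤ-eval (op [*] p q) ρ = trans (fromℤ-* (evalℤ p ρ) (evalℤ q ρ)) (*-cong (fromℤ-eval p ρ) (fromℤ-eval q ρ))
  fromℤ-eval (con i)      ρ = refl
  fromℤ-eval (var i)      ρ = reflexive (≡.sym (lookup-map i fromℤ ρ))
  fromℤ-eval (p :^ n)     ρ = trans (fromℤ-^ (evalℤ p ρ) n) (^-congˡ n (fromℤ-eval p ρ))
    where
    fromℤ-^ : ∀ i n → fromℤ (i ℤ.^ n) ≈ fromℤ i ^ n
    fromℤ-^ i ℕ.zero    = +-identityʳ 1#
    fromℤ-^ i (ℕ.suc n) = trans (fromℤ-* i (i ℤ.^ n)) (*-congˡ (fromℤ-^ i n))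
  fromℤ-eval (:- p)       ρ = trans (fromℤ-neg (evalℤ p ρ)) (-‿cong (fromℤ-eval p ρ))

  x≈y⇒x-y≈0 : x ≈ y → x - y ≈ 0#
  x≈y⇒x-y≈0 {x} {y} x≈y = trans (+-congʳ x≈y) (-‿inverseʳ y)

  x-y≈0⇒x≈y : x - y ≈ 0# → x ≈ y
  x-y≈0⇒x≈y {x} {y} x-y≈0 = begin
    x         ≈⟨ solve 2 (λ x y → x := x :- y :+ y) refl x y ⟩
    x - y + y ≈⟨ +-congʳ x-y≈0 ⟩
    0# + y    ≈⟨ +-identityˡ y ⟩
    y         ∎

  linear : ∀ k → a ≈ b → l - r ≈ k * (a - b) → l ≈ r
  linear k a≈b eq = x-y≈0⇒x≈y (trans eq (trans (*-congˡ (x≈y⇒x-y≈0 a≈b)) (zeroʳ k)))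

  linear₂ : ∀ k k′ → a ≈ b → a′ ≈ b′ → l - r ≈ k * (a - b) + k′ * (a′ - b′) → l ≈ r
  linear₂ k k′ a≈b a′≈b′ eq = linear k a≈b
    (trans eq (trans (+-congˡ (trans (*-congˡ (x≈y⇒x-y≈0 a′≈b′)) (zeroʳ k′))) (+-identityʳ _)))

  linear₃ : ∀ k k′ k″ {a″ b″} → a ≈ b → a′ ≈ b′ → a″ ≈ b″ →
            l - r ≈ k * (a - b) + k′ * (a′ - b′) + k″ * (a″ - b″) → l ≈ r
  linear₃ k k′ k″ a≈b a′≈b′ a″≈b″ eq = linear₂ k k′ a≈b a′≈b′
    (trans eq (trans (+-congˡ (trans (*-congˡ (x≈y⇒x-y≈0 a″≈b″)) (zeroʳ k″))) (+-identityʳ _)))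

  linear₄ : ∀ k k′ k″ k‴ {a″ b″ a‴ b‴} → a ≈ b → a′ ≈ b′ → a″ ≈ b″ → a‴ ≈ b‴ →
            l - r ≈ k * (a - b) + k′ * (a′ - b′) + k″ * (a″ - b″) + k‴ * (a‴ - b‴) → l ≈ r
  linear₄ k k′ k″ k‴ a≈b a′≈b′ a″≈b″ a‴≈b‴ eq = linear₃ k k′ k″ a≈b a′≈b′ a″≈b″
    (trans eq (trans (+-congˡ (trans (*-congˡ (x≈y⇒x-y≈0 a‴≈b‴)) (zeroʳ k‴))) (+-identityʳ _)))

  0<x⇒x#0 : 0# < x → x # 0#
  0<x⇒x#0 0<x = Equivalence.from #⇔<⊎> (inj₂ 0<x)

  0≤x∧x#0⇒0<x : 0# ≤ x → x # 0# → 0# < x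
  0≤x∧x#0⇒0<x 0≤x x#0 with Equivalence.to #⇔<⊎> x#0
  ... | inj₁ x<0 = ⊥-elim (0≤x x<0)
  ... | inj₂ 0<x = 0<x

  0<x⇒0≤x : 0# < x → 0# ≤ x
  0<x⇒0≤x 0<x x<0 = <-irrefl refl (<-trans 0<x x<0)

  1≈ : fromℤ (+ 1) ≈ 1#
  1≈ = +-identityʳ 1#

  xy≈1⇒x#0 : x * y ≈ fromℤ (+ 1) → x # 0#
  xy≈1⇒x#0 {x} {y} xy≈1 = invertibleˡ⇒# (y , trans (*-congˡ (x-0≈x x)) (trans (*-comm y x) (trans xy≈1 1≈)))

  reciprocal : x # 0# → ∃[ y ] x * y ≈ fromℤ (+ 1)
  reciprocal {x} x#0 with #⇒invertible x#0
  ... | y , _ , [x-0]y≈1 = y , trans (*-congʳ (sym (x-0≈x x))) (trans [x-0]y≈1 (sym 1≈))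

  xy≈0⇒y≈0 : x # 0# → x * y ≈ 0# → y ≈ 0#
  xy≈0⇒y≈0 {x} {y} x#0 xy≈0 =
    let x⁻¹ , xx⁻¹≈1 = reciprocal x#0
    in linear₂ (- y) x⁻¹ xx⁻¹≈1 xy≈0
         (solve 3 (λ x y z → y :- con (+ 0) := :- y :* (x :* z :- con (+ 1)) :+ z :* (x :* y :- con (+ 0)))
            refl x y x⁻¹)

  *-cancelˡ-≈ : x # 0# → x * y ≈ x * z → y ≈ z
  *-cancelˡ-≈ {x} {y} {z} x#0 xy≈xz = x-y≈0⇒x≈y (xy≈0⇒y≈0 x#0
    (trans (solve 3 (λ x y z → x :* (y :- z) := x :* y :- x :* z) refl x y z) (x≈y⇒x-y≈0 xy≈xz)))

  +-pos : 0# < x → 0# < y → 0# < x + y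
  +-pos {x} {y} 0<x 0<y = <-trans 0<y (<-respˡ-≈ (+-identityˡ y) (+-monoˡ-< y 0<x))

  -- `0# ≤ x` is only a negation and cannot be split into cases. Since x and x + y are apart,
  -- cotransitivity makes 0 apart from one of them, and the signs are settled from there.
  0≤x∧0<y⇒0<x+y : 0# ≤ x → 0# < y → 0# < x + y
  0≤x∧0<y⇒0<x+y {x} {y} 0≤x 0<y with #-cotrans x#x+y 0#
    where
    x<x+y : x < x + y
    x<x+y = <-respˡ-≈ (+-identityˡ x) (<-respʳ-≈ (+-comm y x) (+-monoˡ-< x 0<y))
    x#x+y : x # (x + y)
    x#x+y = Equivalence.from #⇔<⊎> (inj₁ x<x+y)
  ... | inj₁ x#0 = +-pos (0≤x∧x#0⇒0<x 0≤x x#0) 0<y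
  ... | inj₂ 0#x+y with Equivalence.to #⇔<⊎> 0#x+y
  ...   | inj₁ 0<x+y = 0<x+y
  ...   | inj₂ x+y<0 = ⊥-elim (0≤x (<-trans
    (<-respˡ-≈ (+-identityˡ x) (<-respʳ-≈ (+-comm y x) (+-monoˡ-< x 0<y))) x+y<0))

  -- (√ x + y)(√ x - y) = 0, and strict positivity of y makes the first factor invertible.
  √-unique : ∀ {x y} → 0# < y → x ≈ y * y → √ x ≈ y
  √-unique {x} {y} 0<y x≈yy = x-y≈0⇒x≈y (xy≈0⇒y≈0 s+y#0 (linear₂ (fromℤ (+ 1)) (fromℤ (+ 1)) ss≈x x≈yy
    (solve 3 (λ s x y → (s :+ y) :* (s :- y) :- con (+ 0) :=
                        con (+ 1) :* (s :* s :- x) :+ con (+ 1) :* (x :- y :* y)) refl (√ x) x y)))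
    where
    0<x : 0# < x
    0<x = <-respʳ-≈ (sym x≈yy) (*-pos 0<y 0<y)
    ss≈x : √ x * √ x ≈ x
    ss≈x = √-square (0<x⇒0≤x 0<x)
    s+y#0 : (√ x + y) # 0#
    s+y#0 = 0<x⇒x#0 (0≤x∧0<y⇒0<x+y (√-nonNeg x) 0<y)

  0<fromℤ : ∀ n → 0# < fromℤ (+ ℕ.suc n)
  0<fromℤ ℕ.zero    = <-respʳ-≈ (sym 1≈) 0<1
  0<fromℤ (ℕ.suc n) = +-pos 0<1 (0<fromℤ n)

  0≤fromℤ : ∀ {i} → ℤ.0ℤ ℤ.≤ i → 0# ≤ fromℤ i
  0≤fromℤ {+ ℕ.zero}  _ = <-irrefl refl
  0≤fromℤ {+ ℕ.suc n} _ = 0<x⇒0≤x (0<fromℤ n)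

  fromℤ-pos : ∀ {i} → ℤ.0ℤ ℤ.< i → 0# < fromℤ i
  fromℤ-pos {+ ℕ.suc n} _ = 0<fromℤ n
  fromℤ-pos {+ ℕ.zero}  (ℤ.+<+ ())

  fromℤ≈0⇒≡0 : ∀ i → fromℤ i ≈ 0# → i ≡ ℤ.0ℤ
  fromℤ≈0⇒≡0 (+ ℕ.zero)  _  = ≡.refl
  fromℤ≈0⇒≡0 (+ ℕ.suc n) eq = ⊥-elim (<-irrefl (sym eq) (0<fromℤ n))
  fromℤ≈0⇒≡0 -[1+ n ]    eq = ⊥-elim (<-irrefl
    (sym (trans (sym (-‿involutive _)) (trans (-‿cong eq) -0#≈0#))) (0<fromℤ n))

  fromℤ-injective : ∀ {i j} → fromℤ i ≈ fromℤ j → i ≡ j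
  fromℤ-injective {i} {j} eq = ℤ.i-j≡0⇒i≡j i j (fromℤ≈0⇒≡0 (i ℤ.- j)
    (trans (fromℤ-+ i (ℤ.- j)) (trans (+-congˡ (fromℤ-neg j)) (x≈y⇒x-y≈0 eq))))

  2½≈1 : fromℤ (+ 2) * ½ ≈ fromℤ (+ 1)
  2½≈1 with #⇒invertible 2#0
  ... | y , y[2-0]≈1 , _ = trans (*-congʳ 2≈) (trans (*-comm _ y) (trans y[2-0]≈1 (sym 1≈)))
    where
    2≈ : fromℤ (+ 2) ≈ (1# + 1#) - 0#
    2≈ = trans (+-congˡ 1≈) (sym (x-0≈x _))

  √3²≈3 : √3 * √3 ≈ fromℤ (+ 3)
  √3²≈3 = √-square (0≤fromℤ {+ 3} (ℤ.+≤+ ℕ.z≤n))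

  0<√3 : 0# < √3
  0<√3 = let y , 3y≈1 = reciprocal (0<x⇒x#0 (0<fromℤ 2)) in
    0≤x∧x#0⇒0<x (√-nonNeg _) (xy≈1⇒x#0 (trans (sym (*-assoc √3 √3 y)) (trans (*-congʳ √3²≈3) 3y≈1)))

  0<½ : 0# < ½
  0<½ with Equivalence.to #⇔<⊎> (xy≈1⇒x#0 (trans (*-comm ½ _) 2½≈1))
  ... | inj₂ 0<½ = 0<½
  ... | inj₁ ½<0 = ⊥-elim (<-irrefl (linear (fromℤ (+ 1)) 2½≈1
      (solve 1 (λ h → h :+ h :- con (+ 1) := con (+ 1) :* (con (+ 2) :* h :- con (+ 1))) refl ½))
    (<-trans (<-respˡ-≈ refl (+-monoˡ-< ½ ½<0)) (<-respˡ-≈ (sym (+-identityˡ ½)) (<-trans ½<0 (0<fromℤ 0)))))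

-- Corners of a parallelogram and the isometry that places it

module PlaneGeometry {c ℓ₁ ℓ₂ : Level} (ℝ : Reals c ℓ₁ ℓ₂) where
  open Reals ℝ
  open Plane ℝ
  open RealField ℝ

  normSq : ℂ → Carrier
  normSq z = re z * re z + im z * im z

  dot : ℂ → ℂ → Carrier
  dot z w = re z * re w + im z * im w

  normSq-cong : ∀ {z w} → z ≈ᶜ w → normSq z ≈ normSq w
  normSq-cong (p , q) = +-cong (*-cong p p) (*-cong q q)

  corner : ℂ → ℂ → ℂ → Fin 4 → ℂ
  corner p α β 0F = p
  corner p α β 1F = p +ᶜ α
  corner p α β 2F = (p +ᶜ α) +ᶜ β
  corner p α β 3F = p +ᶜ β

  -- Free of labelling in the same way as `_≅_`: exchanging the two sides, or starting from another
  -- vertex with one side reversed, only permutes the corners.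
  Spanned : Quadrilateral → ℂ → ℂ → ℂ → Set ℓ₁
  Spanned P p α β = (∀ i → ∃[ j ] (P i ≈ᶜ corner p α β j)) × (∀ j → ∃[ i ] (P i ≈ᶜ corner p α β j))

  ≈ᶜ-trans : ∀ {z w v} → z ≈ᶜ w → w ≈ᶜ v → z ≈ᶜ v
  ≈ᶜ-trans (p , q) (p′ , q′) = trans p p′ , trans q q′

  ≈ᶜ-refl : ∀ {z} → z ≈ᶜ z
  ≈ᶜ-refl = refl , refl

  relabel : ∀ {P p α β p′ α′ β′} (π : Fin 4 → Fin 4) → (∀ j → π (π j) ≡ j) →
            (∀ j → corner p α β j ≈ᶜ corner p′ α′ β′ (π j)) →
            Spanned P p α β → Spanned P p′ α′ β′
  relabel {P} {p} {α} {β} {p′} {α′} {β′} π π² eq (to , from) =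
    (λ i → let j , e = to i in π j , ≈ᶜ-trans e (eq j)) ,
    (λ j → let i , e = from (π j) in i ,
      ≡.subst (λ k → P i ≈ᶜ corner p′ α′ β′ k) (π² j) (≈ᶜ-trans e (eq (π j))))

  swap-sides : ∀ {P p α β} → Spanned P p α β → Spanned P p β α
  swap-sides {P} {p} {α} {β} = relabel {P} π π² eq
    where
    π : Fin 4 → Fin 4
    π 0F = 0F
    π 1F = 3F
    π 2F = 2F
    π 3F = 1F
    π² : ∀ j → π (π j) ≡ j
    π² 0F = ≡.refl
    π² 1F = ≡.refl
    π² 2F = ≡.refl
    π² 3F = ≡.refl
    shuffle : ∀ x y z → (x + y) + z ≈ (x + z) + y
    shuffle = solve 3 (λ x y z → (x :+ y) :+ z := (x :+ z) :+ y) refl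
    eq : ∀ j → corner p α β j ≈ᶜ corner p β α (π j)
    eq 0F = ≈ᶜ-refl
    eq 1F = ≈ᶜ-refl
    eq 2F = shuffle _ _ _ , shuffle _ _ _
    eq 3F = ≈ᶜ-refl

  reverse-side : ∀ {P p α α′ β} → re α′ ≈ - re α → im α′ ≈ - im α → Spanned P p α β → Spanned P (p +ᶜ α) α′ β
  reverse-side {P} {p} {α} {α′} {β} re≈ im≈ = relabel {P} π π² eq
    where
    π : Fin 4 → Fin 4
    π 0F = 1F
    π 1F = 0F
    π 2F = 3F
    π 3F = 2F
    π² : ∀ j → π (π j) ≡ j
    π² 0F = ≡.refl
    π² 1F = ≡.refl
    π² 2F = ≡.refl
    π² 3F = ≡.refl
    cancel : ∀ x {a a′} → a′ ≈ - a → x ≈ x + a + a′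
    cancel x {a} {a′} eq = linear (- fromℤ (+ 1)) eq
      (solve 3 (λ x a a′ → x :- (x :+ a :+ a′) := :- con (+ 1) :* (a′ :- :- a)) refl x a a′)
    cancel′ : ∀ x b {a a′} → a′ ≈ - a → x + b ≈ x + a + a′ + b
    cancel′ x b eq = +-congʳ (cancel x eq)
    eq : ∀ j → corner p α β j ≈ᶜ corner (p +ᶜ α) α′ β (π j)
    eq 0F = cancel (re p) re≈ , cancel (im p) im≈
    eq 1F = ≈ᶜ-refl
    eq 2F = ≈ᶜ-refl
    eq 3F = cancel′ (re p) (re β) re≈ , cancel′ (im p) (im β) im≈

  -- Dividing by α / ∣ α ∣ and multiplying by i puts the side α on the imaginary
  -- axis; ε chooses whether to reflect in that axis, and g stands for 1 / ∣ α ∣.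
  module Placement
    (p α β : ℂ) (ε g : Carrier) (k x y : ℤ)
    (εε≈1 : ε * ε ≈ fromℤ (+ 1))
    (∣α∣g≈1 : normSq α * (g * g) ≈ fromℤ (+ 1))
    (α-vertical : normSq α * g ≈ fromℤ k * √3)
    (β-re : ε * cross α β * g ≈ fromℤ x)
    (β-im : dot α β * g ≈ fromℤ y * √3)
    where

    rotate : ℂ → ℂ
    rotate δ = (- (ε * cross α δ * g)) +i (dot α δ * g)

    place : ℂ → ℂ
    place z = rotate (z -ᶜ p)

    rotate-cong : ∀ {z w} → z ≈ᶜ w → rotate z ≈ᶜ rotate w
    rotate-cong (r , i) =
      -‿cong (*-congʳ (*-congˡ (+-cong (*-congˡ i) (-‿cong (*-congˡ r))))) ,
      *-congʳ (+-cong (*-congˡ r) (*-congˡ i))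

    -ᶜ-cong : ∀ {z w v} → z ≈ᶜ w → z -ᶜ v ≈ᶜ w -ᶜ v
    -ᶜ-cong (r , i) = +-congʳ r , +-congʳ i

    rotate-- : ∀ z w → rotate z -ᶜ rotate w ≈ᶜ rotate (z -ᶜ w)
    rotate-- (a +i b) (a′ +i b′) =
      solve 8 (λ A B ε g a b a′ b′ →
        :- (ε :* (A :* b :- B :* a) :* g) :- :- (ε :* (A :* b′ :- B :* a′) :* g) :=
        :- (ε :* (A :* (b :- b′) :- B :* (a :- a′)) :* g)) refl (re α) (im α) ε g a b a′ b′ ,
      solve 7 (λ A B g a b a′ b′ →
        (A :* a :+ B :* b) :* g :- (A :* a′ :+ B :* b′) :* g :=
        (A :* (a :- a′) :+ B :* (b :- b′)) :* g) refl (re α) (im α) g a b a′ b′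

    -- Lagrange's identity: cross² + dot² is the product of the squared lengths of α and δ, and g²
    -- cancels that of α.
    rotate-normSq : ∀ δ → normSq (rotate δ) ≈ normSq δ
    rotate-normSq δ@(a +i b) = linear₂ (cross α δ * cross α δ * (g * g)) (normSq δ) εε≈1 ∣α∣g≈1
      (solve 6 (λ A B ε g a b →
        let cr = A :* b :- B :* a
            dt = A :* a :+ B :* b
            n  = a :* a :+ b :* b
            re = :- (ε :* cr :* g)
            im = dt :* g
        in re :* re :+ im :* im :- n :=
           cr :* cr :* (g :* g) :* (ε :* ε :- con (+ 1)) :+
           n :* ((A :* A :+ B :* B) :* (g :* g) :- con (+ 1))) refl (re α) (im α) ε g a b)

    place-- : ∀ z w → place z -ᶜ place w ≈ᶜ rotate (z -ᶜ w)
    place-- z w = ≈ᶜ-trans (rotate-- (z -ᶜ p) (w -ᶜ p)) (rotate-cong (cancel _ _ _ , cancel _ _ _))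
      where
      cancel : ∀ z w p → (z - p) - (w - p) ≈ z - w
      cancel = solve 3 (λ z w p → (z :- p) :- (w :- p) := z :- w) refl

    place-isometry : IsEuclideanTransformation place
    place-isometry z w = √-cong (trans (normSq-cong (place-- z w)) (rotate-normSq (z -ᶜ w)))

    place-corner : ∀ j → place (corner p α β j) ≈ᶜ verticalParallelogram k x y j
    place-corner 0F =
      solve 6 (λ A B ε g p q → :- (ε :* (A :* (q :- q) :- B :* (p :- p)) :* g) := con (+ 0)) refl
        (re α) (im α) ε g (re p) (im p) ,
      solve 6 (λ A B g p q s → (A :* (p :- p) :+ B :* (q :- q)) :* g := con (+ 0) :* s) refl
        (re α) (im α) g (re p) (im p) √3
    place-corner 1F = ≈ᶜ-trans (rotate-cong (cancel _ _ , cancel _ _))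
      ( solve 4 (λ A B ε g → :- (ε :* (A :* B :- B :* A) :* g) := con (+ 0)) refl (re α) (im α) ε g
      , α-vertical)
      where
      cancel : ∀ p a → p + a - p ≈ a
      cancel = solve 2 (λ p a → p :+ a :- p := a) refl
    place-corner 2F = ≈ᶜ-trans (rotate-cong {w = α +ᶜ β} (cancel _ _ _ , cancel _ _ _))
      ( linear₂ (- fromℤ (+ 1)) (- fromℤ (+ 1)) β-re (fromℤ-neg x)
          (solve 8 (λ A B ε g a b x x′ →
            :- (ε :* (A :* (B :+ b) :- B :* (A :+ a)) :* g) :- x′ :=
            :- con (+ 1) :* (ε :* (A :* b :- B :* a) :* g :- x) :+ :- con (+ 1) :* (x′ :- :- x))
            refl (re α) (im α) ε g (re β) (im β) (fromℤ x) (fromℤ (ℤ.- x)))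
      , linear₃ (fromℤ (+ 1)) (fromℤ (+ 1)) (- √3) α-vertical β-im (fromℤ-+ k y)
          (solve 9 (λ A B g a b k y ky s →
            (A :* (A :+ a) :+ B :* (B :+ b)) :* g :- ky :* s :=
            con (+ 1) :* ((A :* A :+ B :* B) :* g :- k :* s) :+
            con (+ 1) :* ((A :* a :+ B :* b) :* g :- y :* s) :+ :- s :* (ky :- (k :+ y)))
            refl (re α) (im α) g (re β) (im β) (fromℤ k) (fromℤ y) (fromℤ (k ℤ.+ y)) √3))
      where
      cancel : ∀ p a b → p + a + b - p ≈ a + b
      cancel = solve 3 (λ p a b → p :+ a :+ b :- p := a :+ b) refl
    place-corner 3F = ≈ᶜ-trans (rotate-cong (cancel _ _ , cancel _ _))
      (trans (-‿cong β-re) (sym (fromℤ-neg x)) , β-im)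
      where
      cancel : ∀ p a → p + a - p ≈ a
      cancel = solve 2 (λ p a → p :+ a :- p := a) refl

    placed : ∀ {P} → Spanned P p α β → P ≅ verticalParallelogram k x y
    placed (to , from) = place , place-isometry ,
      (λ i → let j , e = to i in j , ≈ᶜ-trans (rotate-cong (-ᶜ-cong e)) (place-corner j)) ,
      (λ j → let i , e = from j in i , ≈ᶜ-trans (rotate-cong (-ᶜ-cong e)) (place-corner j))

-- Integral norm, determinant and inner product of Eisenstein integers

norm : ℤ → ℤ → ℤ
norm a b = a ℤ.* a ℤ.- a ℤ.* b ℤ.+ b ℤ.* b

det : ℤ → ℤ → ℤ → ℤ → ℤ
det a b c d = a ℤ.* d ℤ.- b ℤ.* c

-- Twice the inner product of a + bω and c + dω.
inner : ℤ → ℤ → ℤ → ℤ → ℤ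
inner a b c d = + 2 ℤ.* a ℤ.* c ℤ.- a ℤ.* d ℤ.- b ℤ.* c ℤ.+ + 2 ℤ.* b ℤ.* d

-- Multiplicativity of the norm for the product of one number with the conjugate of the other: its
-- real part is `inner` / 2 and its imaginary part is, up to sign, `det` · √3 / 2.
lagrange : ∀ a b c d → inner a b c d ℤ.* inner a b c d ℤ.+ + 3 ℤ.* (det a b c d ℤ.* det a b c d) ≡
                       + 4 ℤ.* (norm a b ℤ.* norm c d)
lagrange a b c d = identity a b c d
  where
  identity : ∀ a b c d → let q = + 2 ℤ.* a ℤ.* c ℤ.- a ℤ.* d ℤ.- b ℤ.* c ℤ.+ + 2 ℤ.* b ℤ.* d in
    q ℤ.* q ℤ.+ + 3 ℤ.* ((a ℤ.* d ℤ.- b ℤ.* c) ℤ.* (a ℤ.* d ℤ.- b ℤ.* c)) ≡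
    + 4 ℤ.* ((a ℤ.* a ℤ.- a ℤ.* b ℤ.+ b ℤ.* b) ℤ.* (c ℤ.* c ℤ.- c ℤ.* d ℤ.+ d ℤ.* d))
  identity = ℤ-Solver.solve-∀

module LatticeVectors {c ℓ₁ ℓ₂ : Level} (ℝ : Reals c ℓ₁ ℓ₂) where
  open Reals ℝ
  open Plane ℝ
  open RealField ℝ
  open PlaneGeometry ℝ

  vec : ℤ → ℤ → ℂ
  vec a b = (fromℤ a - fromℤ b * ½) +i (fromℤ b * (½ * √3))

  ∈ℤ[ω]⇒vec : ∀ {z} → z ∈ℤ[ω] → ∃[ a ] ∃[ b ] (z ≈ᶜ vec a b)
  ∈ℤ[ω]⇒vec (a , b , z≈) = a , b , ≈ᶜ-trans z≈
    ( solve 4 (λ a b h s → a :+ (b :* :- h :- con (+ 0) :* (h :* s)) := a :- b :* h) refl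
        (fromℤ a) (fromℤ b) ½ √3
    , solve 3 (λ b h s → con (+ 0) :+ (b :* (h :* s) :+ con (+ 0) :* :- h) := b :* (h :* s)) refl
        (fromℤ b) ½ √3)

  vec-- : ∀ a b c d → vec a b -ᶜ vec c d ≈ᶜ vec (a ℤ.- c) (b ℤ.- d)
  vec-- a b c d =
    linear₂ (- fromℤ (+ 1)) ½ (fromℤ-eval (var 0F :- var 1F) (a ∷ c ∷ [])) (fromℤ-eval (var 0F :- var 1F) (b ∷ d ∷ []))
      (solve 7 (λ a b c d a-c b-d h → (a :- b :* h) :- (c :- d :* h) :- (a-c :- b-d :* h) :=
         :- con (+ 1) :* (a-c :- (a :- c)) :+ h :* (b-d :- (b :- d))) refl
         (fromℤ a) (fromℤ b) (fromℤ c) (fromℤ d) (fromℤ (a ℤ.- c)) (fromℤ (b ℤ.- d)) ½) ,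
    linear (- (½ * √3)) (fromℤ-eval (var 0F :- var 1F) (b ∷ d ∷ []))
      (solve 4 (λ b d b-d hs → b :* hs :- d :* hs :- b-d :* hs := :- hs :* (b-d :- (b :- d))) refl
         (fromℤ b) (fromℤ d) (fromℤ (b ℤ.- d)) (½ * √3))

  vec-neg : ∀ a b → re (vec (ℤ.- a) (ℤ.- b)) ≈ - re (vec a b) × im (vec (ℤ.- a) (ℤ.- b)) ≈ - im (vec a b)
  vec-neg a b =
    trans (+-cong (fromℤ-neg a) (-‿cong (*-congʳ (fromℤ-neg b))))
      (solve 3 (λ a b h → :- a :- :- b :* h := :- (a :- b :* h)) refl (fromℤ a) (fromℤ b) ½) ,
    trans (*-congʳ (fromℤ-neg b))
      (solve 2 (λ b hs → :- b :* hs := :- (b :* hs)) refl (fromℤ b) (½ * √3))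

  -- Here and in `vec-dot`, ½ and √3 are indeterminates for the solver; the cofactors express the
  -- identity modulo 2 · ½ = 1 and √3² = 3.
  vec-normSq : ∀ a b → normSq (vec a b) ≈ fromℤ (norm a b)
  vec-normSq a b = linear₃ (- (A * B) + B * B * (fromℤ (+ 2) * ½ + fromℤ (+ 1))) (B * B * (½ * ½)) (- fromℤ (+ 1))
    2½≈1 √3²≈3 (fromℤ-eval (x :* x :- x :* y :+ y :* y) (a ∷ b ∷ []))
    (solve 5 (λ a b n h s →
       (a :- b :* h) :* (a :- b :* h) :+ (b :* (h :* s)) :* (b :* (h :* s)) :- n :=
       (:- (a :* b) :+ b :* b :* (con (+ 2) :* h :+ con (+ 1))) :* (con (+ 2) :* h :- con (+ 1)) :+
       (b :* b :* (h :* h)) :* (s :* s :- con (+ 3)) :+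
       :- con (+ 1) :* (n :- (a :* a :- a :* b :+ b :* b))) refl
       A B (fromℤ (norm a b)) ½ √3)
    where
    A = fromℤ a
    B = fromℤ b
    x y : Polynomial 2
    x = var 0F
    y = var 1F

  vec-cross : ∀ a b c d → cross (vec a b) (vec c d) ≈ fromℤ (det a b c d) * (½ * √3)
  vec-cross a b c d = linear (- (½ * √3)) (fromℤ-eval (var 0F :* var 3F :- var 1F :* var 2F) (a ∷ b ∷ c ∷ d ∷ []))
    (solve 7 (λ a b c d D h s →
       (a :- b :* h) :* (d :* (h :* s)) :- (b :* (h :* s)) :* (c :- d :* h) :- D :* (h :* s) :=
       :- (h :* s) :* (D :- (a :* d :- b :* c))) refl
       (fromℤ a) (fromℤ b) (fromℤ c) (fromℤ d) (fromℤ (det a b c d)) ½ √3)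

  vec-dot : ∀ a b c d → fromℤ (+ 2) * dot (vec a b) (vec c d) ≈ fromℤ (inner a b c d)
  vec-dot a b c d = linear₃ (fromℤ (+ 2) * B * D * (fromℤ (+ 2) * ½ + fromℤ (+ 1)) - (A * D + B * C))
    (fromℤ (+ 2) * (B * D) * (½ * ½)) (- fromℤ (+ 1))
    2½≈1 √3²≈3 (fromℤ-eval poly (a ∷ b ∷ c ∷ d ∷ []))
    (solve 7 (λ a b c d q h s →
       con (+ 2) :* ((a :- b :* h) :* (c :- d :* h) :+ (b :* (h :* s)) :* (d :* (h :* s))) :- q :=
       (con (+ 2) :* b :* d :* (con (+ 2) :* h :+ con (+ 1)) :- (a :* d :+ b :* c)) :* (con (+ 2) :* h :- con (+ 1)) :+
       (con (+ 2) :* (b :* d) :* (h :* h)) :* (s :* s :- con (+ 3)) :+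
       :- con (+ 1) :* (q :- (con (+ 2) :* a :* c :- a :* d :- b :* c :+ con (+ 2) :* b :* d))) refl
       A B C D (fromℤ (inner a b c d)) ½ √3)
    where
    A = fromℤ a
    B = fromℤ b
    C = fromℤ c
    D = fromℤ d
    poly : Polynomial 4
    poly = con (+ 2) :* var 0F :* var 2F :- var 0F :* var 3F :- var 1F :* var 2F :+ con (+ 2) :* var 1F :* var 3F

  fromℤ-cong : ∀ {i j} → i ≡ j → fromℤ i ≈ fromℤ j
  fromℤ-cong i≡j = reflexive (≡.cong fromℤ i≡j)

  private
    -- With ∣ α ∣ = r√3, the coordinates of the placed side β are cross / (r√3) = det / (2r) and dot
    -- / (r√3) = inner · √3 / (6r). Hence the factors 2r and 6r.
    place-vec : ∀ {P p a b c d} r x v ε → ε * ε ≈ fromℤ (+ 1) → ℤ.0ℤ ℤ.< r →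
      norm a b ≡ r ℤ.* r ℤ.* + 3 →
      ε * fromℤ (det a b c d) ≈ fromℤ (+ 2 ℤ.* r ℤ.* x) →
      inner a b c d ≡ + 6 ℤ.* r ℤ.* v →
      Spanned P p (vec a b) (vec c d) → P ≅ verticalParallelogram r x v
    place-vec {p = p} {a} {b} {c} {d} r x v ε εε≈1 0<r norm≡ det≈ inner≡ =
      Placement.placed p (vec a b) (vec c d) ε g r x v εε≈1 ∣α∣g≈1 α-vertical β-re β-im
      where
      ϱ = fromℤ r
      r⁻¹ = reciprocal (0<x⇒x#0 (fromℤ-pos 0<r))
      3⁻¹ = reciprocal (0<x⇒x#0 (0<fromℤ 2))
      ρ = proj₁ r⁻¹
      τ = proj₁ 3⁻¹
      -- `τ` is 1/3 and `ρ` is 1/r, so this is 1 / (r√3).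
      g = √3 * (τ * ρ)
      normSq≈ : normSq (vec a b) ≈ ϱ * ϱ * fromℤ (+ 3)
      normSq≈ = trans (vec-normSq a b) (trans (fromℤ-cong norm≡)
        (fromℤ-eval (var 0F :* var 0F :* con (+ 3)) (r ∷ [])))
      3τ≈1 : fromℤ (+ 3) * τ ≈ fromℤ (+ 1)
      3τ≈1 = proj₂ 3⁻¹
      Rρ≈1 : ϱ * ρ ≈ fromℤ (+ 1)
      Rρ≈1 = proj₂ r⁻¹
      N = normSq (vec a b)
      three = fromℤ (+ 3)
      α-vertical : N * g ≈ ϱ * √3
      α-vertical = linear₃ g (ϱ * √3 * (ϱ * ρ)) (ϱ * √3) normSq≈ 3τ≈1 Rρ≈1
        (solve 5 (λ N ϱ s t ρ → N :* (s :* (t :* ρ)) :- ϱ :* s :=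
          (s :* (t :* ρ)) :* (N :- ϱ :* ϱ :* con (+ 3)) :+
          ϱ :* s :* (ϱ :* ρ) :* (con (+ 3) :* t :- con (+ 1)) :+
          ϱ :* s :* (ϱ :* ρ :- con (+ 1))) refl N ϱ √3 τ ρ)
      ∣α∣g≈1 : N * (g * g) ≈ fromℤ (+ 1)
      ∣α∣g≈1 = linear₄ g (ϱ * (τ * ρ)) (ϱ * ρ) (fromℤ (+ 1)) α-vertical √3²≈3 3τ≈1 Rρ≈1
        (solve 5 (λ N ϱ s t ρ → let g = s :* (t :* ρ) in
          N :* (g :* g) :- con (+ 1) :=
          g :* (N :* g :- ϱ :* s) :+ ϱ :* (t :* ρ) :* (s :* s :- con (+ 3)) :+
          ϱ :* ρ :* (con (+ 3) :* t :- con (+ 1)) :+ con (+ 1) :* (ϱ :* ρ :- con (+ 1))) refl N ϱ √3 τ ρ)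
      D = fromℤ (det a b c d)
      X = fromℤ x
      V = fromℤ v
      det≈′ : ε * D ≈ fromℤ (+ 2) * ϱ * X
      det≈′ = trans det≈ (fromℤ-eval (con (+ 2) :* var 0F :* var 1F) (r ∷ x ∷ []))
      β-re : ε * cross (vec a b) (vec c d) * g ≈ X
      β-re = trans (*-congʳ (*-congˡ (vec-cross a b c d)))
        (trans (solve 6 (λ ε D h s t ρ → ε :* (D :* (h :* s)) :* (s :* (t :* ρ)) :=
                 (ε :* D) :* ((s :* s) :* (h :* (t :* ρ)))) refl ε D ½ √3 τ ρ)
        (trans (*-cong det≈′ (*-congʳ √3²≈3))
        (linear₃ (ϱ * X * three * τ * ρ) (ϱ * X * ρ) X 2½≈1 3τ≈1 Rρ≈1
          (solve 5 (λ ϱ X h t ρ → con (+ 2) :* ϱ :* X :* (con (+ 3) :* (h :* (t :* ρ))) :- X :=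
            ϱ :* X :* con (+ 3) :* t :* ρ :* (con (+ 2) :* h :- con (+ 1)) :+
            ϱ :* X :* ρ :* (con (+ 3) :* t :- con (+ 1)) :+ X :* (ϱ :* ρ :- con (+ 1))) refl ϱ X ½ τ ρ))))
      dt = dot (vec a b) (vec c d)
      2dot≈ : fromℤ (+ 2) * dt ≈ fromℤ (+ 6) * ϱ * V
      2dot≈ = trans (vec-dot a b c d) (trans (fromℤ-cong inner≡)
        (fromℤ-eval (con (+ 6) :* var 0F :* var 1F) (r ∷ v ∷ [])))
      β-im : dt * g ≈ V * √3
      β-im = linear₄ (½ * g) (fromℤ (+ 3) * ϱ * V * g - dt * g) (V * √3 * ϱ * ρ) (V * √3) 2dot≈ 2½≈1 3τ≈1 Rρ≈1
        (solve 7 (λ q ϱ V h s t ρ → let g = s :* (t :* ρ) in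
          q :* g :- V :* s :=
          h :* g :* (con (+ 2) :* q :- con (+ 6) :* ϱ :* V) :+
          (con (+ 3) :* ϱ :* V :* g :- q :* g) :* (con (+ 2) :* h :- con (+ 1)) :+
          V :* s :* ϱ :* ρ :* (con (+ 3) :* t :- con (+ 1)) :+ V :* s :* (ϱ :* ρ :- con (+ 1)))
          refl dt ϱ V ½ √3 τ ρ)

    1·1≈1 : fromℤ (+ 1) * fromℤ (+ 1) ≈ fromℤ (+ 1)
    1·1≈1 = solve 0 (con (+ 1) :* con (+ 1) := con (+ 1)) refl

    -1·-1≈1 : - fromℤ (+ 1) * - fromℤ (+ 1) ≈ fromℤ (+ 1)
    -1·-1≈1 = solve 0 (:- con (+ 1) :* :- con (+ 1) := con (+ 1)) refl

    place-vec-± : ∀ {P p a b c d r x v} → ℤ.0ℤ ℤ.< r →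
      norm a b ≡ r ℤ.* r ℤ.* + 3 →
      det a b c d ≡ + 2 ℤ.* r ℤ.* x ⊎ det a b c d ≡ ℤ.- (+ 2 ℤ.* r ℤ.* x) →
      inner a b c d ≡ + 6 ℤ.* r ℤ.* v →
      Spanned P p (vec a b) (vec c d) → P ≅ verticalParallelogram r x v
    place-vec-± {P} {p} {a} {b} {c} {d} {r} {x} {v} 0<r norm≡ (inj₁ det≡) inner≡ =
      place-vec {P} {p} {a} {b} {c} {d} r x v (fromℤ (+ 1)) 1·1≈1 0<r norm≡
        (trans (*-congˡ (fromℤ-cong det≡)) (solve 1 (λ x → con (+ 1) :* x := x) refl _)) inner≡
    place-vec-± {P} {p} {a} {b} {c} {d} {r} {x} {v} 0<r norm≡ (inj₂ det≡) inner≡ =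
      place-vec {P} {p} {a} {b} {c} {d} r x v (- fromℤ (+ 1)) -1·-1≈1 0<r norm≡
        (trans (*-congˡ (trans (fromℤ-cong det≡) (fromℤ-neg (+ 2 ℤ.* r ℤ.* x))))
               (solve 1 (λ x → :- con (+ 1) :* :- x := x) refl _)) inner≡

  -- Both signs are matters of position. The sign of the determinant is absorbed by the reflection
  -- ε; a negative inner product is made positive by reversing α, which also flips the determinant.
  congruent-to-vertical : ∀ {P p a b c d} r x v → ℤ.0ℤ ℤ.< r →
    norm a b ≡ r ℤ.* r ℤ.* + 3 →
    det a b c d ≡ + 2 ℤ.* r ℤ.* x ⊎ det a b c d ≡ ℤ.- (+ 2 ℤ.* r ℤ.* x) →
    inner a b c d ≡ + 6 ℤ.* r ℤ.* v ⊎ inner a b c d ≡ ℤ.- (+ 6 ℤ.* r ℤ.* v) →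
    Spanned P p (vec a b) (vec c d) → P ≅ verticalParallelogram r x v
  congruent-to-vertical {P} {p} {a} {b} {c} {d} r x v 0<r norm≡ det± (inj₁ inner≡) =
    place-vec-± {P} {p} {a} {b} {c} {d} {r} {x} {v} 0<r norm≡ det± inner≡
  congruent-to-vertical {P} {p} {a} {b} {c} {d} r x v 0<r norm≡ det± (inj₂ inner≡) spanned =
    place-vec-± {P} {p +ᶜ vec a b} {ℤ.- a} {ℤ.- b} {c} {d} {r} {x} {v} 0<r
      (≡.trans (norm-neg a b) norm≡) (flip det±)
      (≡.trans (inner-neg a b c d) (≡.trans (≡.cong ℤ.-_ inner≡) (ℤ.neg-involutive _)))
      (reverse-side {P} {p} {vec a b} {vec (ℤ.- a) (ℤ.- b)} {vec c d} (proj₁ (vec-neg a b)) (proj₂ (vec-neg a b)) spanned)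
    where
    norm-neg : ∀ a b → ℤ.- a ℤ.* ℤ.- a ℤ.- ℤ.- a ℤ.* ℤ.- b ℤ.+ ℤ.- b ℤ.* ℤ.- b ≡
                       a ℤ.* a ℤ.- a ℤ.* b ℤ.+ b ℤ.* b
    norm-neg = ℤ-Solver.solve-∀
    det-neg : ∀ a b c d → ℤ.- a ℤ.* d ℤ.- ℤ.- b ℤ.* c ≡ ℤ.- (a ℤ.* d ℤ.- b ℤ.* c)
    det-neg = ℤ-Solver.solve-∀
    inner-neg : ∀ a b c d →
      + 2 ℤ.* (ℤ.- a) ℤ.* c ℤ.- (ℤ.- a) ℤ.* d ℤ.- (ℤ.- b) ℤ.* c ℤ.+ + 2 ℤ.* (ℤ.- b) ℤ.* d ≡
      ℤ.- (+ 2 ℤ.* a ℤ.* c ℤ.- a ℤ.* d ℤ.- b ℤ.* c ℤ.+ + 2 ℤ.* b ℤ.* d)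
    inner-neg = ℤ-Solver.solve-∀
    flip : ∀ {s} → det a b c d ≡ s ⊎ det a b c d ≡ ℤ.- s →
           det (ℤ.- a) (ℤ.- b) c d ≡ s ⊎ det (ℤ.- a) (ℤ.- b) c d ≡ ℤ.- s
    flip (inj₁ eq) = inj₂ (≡.trans (det-neg a b c d) (≡.cong ℤ.-_ eq))
    flip (inj₂ eq) = inj₁ (≡.trans (det-neg a b c d) (≡.trans (≡.cong ℤ.-_ eq) (ℤ.neg-involutive _)))

4norm : ∀ a b → (+ 2 ℤ.* a ℤ.- b) ℤ.* (+ 2 ℤ.* a ℤ.- b) ℤ.+ + 3 ℤ.* (b ℤ.* b) ≡ + 4 ℤ.* norm a b
4norm = identity
  where
  identity : ∀ a b → (+ 2 ℤ.* a ℤ.- b) ℤ.* (+ 2 ℤ.* a ℤ.- b) ℤ.+ + 3 ℤ.* (b ℤ.* b) ≡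
                     + 4 ℤ.* (a ℤ.* a ℤ.- a ℤ.* b ℤ.+ b ℤ.* b)
  identity = ℤ-Solver.solve-∀

0≤norm : ∀ a b → ℤ.0ℤ ℤ.≤ norm a b
0≤norm a b = ℤ.*-cancelˡ-≤-pos ℤ.0ℤ (norm a b) (+ 4) (≡.subst (ℤ.0ℤ ℤ.≤_) (4norm a b)
  (0≤-+ (0≤-square (+ 2 ℤ.* a ℤ.- b)) (0≤-* {+ 3} 0≤+ (0≤-square b))))

0<abs : ∀ {i} → i ≢ ℤ.0ℤ → ℤ.0ℤ ℤ.< + ℤ.∣ i ∣
0<abs {+ ℕ.zero}  i≢0 = ⊥-elim (i≢0 ≡.refl)
0<abs {+ ℕ.suc _} _   = 0<+suc
0<abs { -[1+ _ ]} _   = 0<+suc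

factor≢0 : ∀ {n n′ q D} → D ≢ ℤ.0ℤ → q ℤ.* q ℤ.+ + 3 ℤ.* (D ℤ.* D) ≡ + 4 ℤ.* (n ℤ.* n′) →
           n ≢ ℤ.0ℤ
factor≢0 {n′ = n′} {q} {D} D≢0 eq ≡.refl = ℤ.<-irrefl (≡.sym eq) (ℤ.+-mono-≤-< (0≤-square q)
  (0<-* {+ 3} 0<+suc (≡.subst (ℤ.0ℤ ℤ.<_) (abs-square D) (0<-* (0<abs D≢0) (0<abs D≢0)))))

-- Integral data of an equable lattice parallelogram

module Analysis {ℓ₀ ℓ₁ ℓ₂ : Level} (ℝ : Reals ℓ₀ ℓ₁ ℓ₂) where
  open Reals ℝ
  open Plane ℝ
  open RealField ℝ
  open PlaneGeometry ℝ
  open LatticeVectors ℝ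

  √-rational : ∀ n n′ Δ → ℤ.0ℤ ℤ.≤ n → ℤ.0ℤ ℤ.≤ n′ → Δ ≢ ℤ.0ℤ →
               fromℤ (+ 4) * (√ fromℤ n + √ fromℤ n′) ≈ √3 * fromℤ Δ →
               ∃[ t ] n′ ≡ + t ℤ.* + t ℤ.* + 3
  √-rational n n′ Δ 0≤n 0≤n′ Δ≢0 equable =
    rational-root n′ (+ 4 ℤ.* Δ) G 0≤n′ 4Δ≢0 (fromℤ-injective
      (trans (fromℤ-eval (var 0F :* con (+ 12) :* (con (+ 4) :* var 1F :* (con (+ 4) :* var 1F))) (n′ ∷ Δ ∷ []))
        (trans squared (sym (fromℤ-* G G)))))
    where
    -- Squaring 4 √ n = √3 Δ - 4 √ n′ gives 8 √3 Δ √ n′ = G.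
    G = + 3 ℤ.* (Δ ℤ.* Δ) ℤ.+ + 16 ℤ.* n′ ℤ.- + 16 ℤ.* n
    4Δ≢0 : + 4 ℤ.* Δ ≢ ℤ.0ℤ
    4Δ≢0 4Δ≡0 with ℤ.i*j≡0⇒i≡0∨j≡0 (+ 4) {Δ} 4Δ≡0
    ... | inj₂ Δ≡0 = Δ≢0 Δ≡0
    S = √ fromℤ n
    T = √ fromℤ n′
    Δ′ = fromℤ Δ
    eight = fromℤ (+ 8)
    SS≈n : S * S ≈ fromℤ n
    SS≈n = √-square (0≤fromℤ 0≤n)
    TT≈n′ : T * T ≈ fromℤ n′
    TT≈n′ = √-square (0≤fromℤ 0≤n′)
    G≈ : fromℤ G ≈ eight * √3 * Δ′ * T
    G≈ = trans (fromℤ-eval (con (+ 3) :* (var 0F :* var 0F) :+ con (+ 16) :* var 1F :- con (+ 16) :* var 2F) (Δ ∷ n′ ∷ n ∷ []))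
      (linear₄ (- (Δ′ * Δ′)) (- fromℤ (+ 16)) (fromℤ (+ 16)) (- (fromℤ (+ 4) * S + √3 * Δ′ - fromℤ (+ 4) * T))
        √3²≈3 TT≈n′ SS≈n equable
        (solve 6 (λ S T n n′ D s →
          con (+ 3) :* (D :* D) :+ con (+ 16) :* n′ :- con (+ 16) :* n :- con (+ 8) :* s :* D :* T :=
          :- (D :* D) :* (s :* s :- con (+ 3)) :+ :- con (+ 16) :* (T :* T :- n′) :+
          con (+ 16) :* (S :* S :- n) :+
          :- (con (+ 4) :* S :+ s :* D :- con (+ 4) :* T) :* (con (+ 4) :* (S :+ T) :- s :* D))
          refl S T (fromℤ n) (fromℤ n′) Δ′ √3))
    squared : fromℤ n′ * fromℤ (+ 12) * (fromℤ (+ 4) * Δ′ * (fromℤ (+ 4) * Δ′)) ≈ fromℤ G * fromℤ G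
    squared = linear₃ (- (fromℤ G + eight * √3 * Δ′ * T)) (- fromℤ (+ 64) * Δ′ * Δ′ * (T * T))
      (- fromℤ (+ 192) * Δ′ * Δ′) G≈ √3²≈3 TT≈n′
      (solve 5 (λ T n′ D s G →
        n′ :* con (+ 12) :* (con (+ 4) :* D :* (con (+ 4) :* D)) :- G :* G :=
        :- (G :+ con (+ 8) :* s :* D :* T) :* (G :- con (+ 8) :* s :* D :* T) :+
        :- con (+ 64) :* D :* D :* (T :* T) :* (s :* s :- con (+ 3)) :+
        :- con (+ 192) :* D :* D :* (T :* T :- n′)) refl T (fromℤ n′) Δ′ √3 (fromℤ G))

  √-3square : ∀ {r n} → ℤ.0ℤ ℤ.< r → n ≡ r ℤ.* r ℤ.* + 3 → √ fromℤ n ≈ fromℤ r * √3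
  √-3square {r} 0<r ≡.refl = √-unique (*-pos (fromℤ-pos 0<r) 0<√3)
    (trans (fromℤ-eval (var 0F :* var 0F :* con (+ 3)) (r ∷ []))
      (linear (- (fromℤ r * fromℤ r)) √3²≈3
        (solve 2 (λ r s → r :* r :* con (+ 3) :- (r :* s) :* (r :* s) := :- (r :* r) :* (s :* s :- con (+ 3)))
          refl (fromℤ r) √3)))

  -- The vertices of P are p, p + α, p + α + β, p + β with α = a + bω of length
  -- r√3 and β = c + dω of length t√3.
  record Lattice (P : Quadrilateral) : Set (ℓ₀ ⊔ ℓ₁) where
    field
      p           : ℂ
      a b c d r t : ℤ
      spanned     : Spanned P p (vec a b) (vec c d)
      0<r         : ℤ.0ℤ ℤ.< r
      0<t         : ℤ.0ℤ ℤ.< t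
      norm₁       : norm a b ≡ r ℤ.* r ℤ.* + 3
      norm₂       : norm c d ≡ t ℤ.* t ℤ.* + 3
      det±        : det a b c d ≡ + 4 ℤ.* (r ℤ.+ t) ⊎ det a b c d ≡ ℤ.- (+ 4 ℤ.* (r ℤ.+ t))
      side₁       : HasSideOfLength (fromℤ r * √3) P
      side₂       : HasSideOfLength (fromℤ t * √3) P
      lengths     : ∀ k → HasSideOfLength (fromℤ k * √3) P → k ≡ r ⊎ k ≡ t
      verticals   : HasVerticalSide P → b ≡ + 2 ℤ.* a ⊎ d ≡ + 2 ℤ.* c

  -- Lets the side under consideration always be the first one.
  swap-lattice : ∀ {P} → Lattice P → Lattice P
  swap-lattice {P} L = record
    { p = p ; a = c ; b = d ; c = a ; d = b ; r = t ; t = r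
    ; spanned = swap-sides {P} {p} {vec a b} {vec c d} spanned
    ; 0<r = 0<t ; 0<t = 0<r ; norm₁ = norm₂ ; norm₂ = norm₁
    ; det± = flip (det-swap a b c d) det±
    ; side₁ = side₂ ; side₂ = side₁
    ; lengths = λ k h → Sum.swap (lengths k h)
    ; verticals = λ h → Sum.swap (verticals h)
    }
    where
    open Lattice L
    det-swap : ∀ a b c d → c ℤ.* b ℤ.- d ℤ.* a ≡ ℤ.- (a ℤ.* d ℤ.- b ℤ.* c)
    det-swap = ℤ-Solver.solve-∀
    flip : ∀ {D D′} → D′ ≡ ℤ.- D → D ≡ + 4 ℤ.* (r ℤ.+ t) ⊎ D ≡ ℤ.- (+ 4 ℤ.* (r ℤ.+ t)) →
           D′ ≡ + 4 ℤ.* (t ℤ.+ r) ⊎ D′ ≡ ℤ.- (+ 4 ℤ.* (t ℤ.+ r))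
    flip e (inj₁ ≡.refl) = inj₂ (≡.trans e (≡.cong (λ s → ℤ.- (+ 4 ℤ.* s)) (ℤ.+-comm r t)))
    flip e (inj₂ ≡.refl) = inj₁ (≡.trans e (≡.trans (ℤ.neg-involutive _) (≡.cong (+ 4 ℤ.*_) (ℤ.+-comm r t))))

  infix 4 _≈±_
  _≈±_ : ℂ → ℂ → Set ℓ₁
  z ≈± w = (z ≈ᶜ w) ⊎ (re z ≈ - re w × im z ≈ - im w)

  ≈±-normSq : ∀ {z w} → z ≈± w → normSq z ≈ normSq w
  ≈±-normSq (inj₁ z≈w) = normSq-cong z≈w
  ≈±-normSq {z} {w} (inj₂ (r , i)) = trans (+-cong (*-cong r r) (*-cong i i))
    (solve 2 (λ x y → :- x :* :- x :+ :- y :* :- y := x :* x :+ y :* y) refl (re w) (im w))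

  ≈±-modulus : ∀ {z a b} → z ≈± vec a b → modulus z ≈ √ fromℤ (norm a b)
  ≈±-modulus {z} {a} {b} z≈ = √-cong (trans (≈±-normSq z≈) (vec-normSq a b))

  ≈±-vertical : ∀ {z a b} → z ≈± vec a b → re z ≈ 0# → b ≡ + 2 ℤ.* a
  ≈±-vertical {z} {a} {b} z≈ re≈0 = fromℤ-injective (trans
    (linear₂ (- fromℤ (+ 2)) (- fromℤ b) (vec-re z≈) 2½≈1
      (solve 3 (λ a b h → b :- con (+ 2) :* a :=
        :- con (+ 2) :* (a :- b :* h :- con (+ 0)) :+ :- b :* (con (+ 2) :* h :- con (+ 1)))
        refl (fromℤ a) (fromℤ b) ½))
    (sym (fromℤ-* (+ 2) a)))
    where
    vec-re : z ≈± vec a b → re (vec a b) ≈ 0#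
    vec-re (inj₁ (r , _)) = trans (sym r) re≈0
    vec-re (inj₂ (r , _)) = linear₂ (fromℤ (+ 1)) (- fromℤ (+ 1)) r re≈0
      (solve 2 (λ w z → w :- con (+ 0) := con (+ 1) :* (z :- :- w) :+ :- con (+ 1) :* (z :- con (+ 0)))
         refl (re (vec a b)) (re z))

  lattice : ∀ P → IsELEP P → Lattice P
  lattice P ((parallel , nondegenerate) , vertices , equable) = record
    { p = P 0F ; a = a ; b = b ; c = c′ ; d = d ; r = + r ; t = + t
    ; spanned = (λ i → i , corner-eq i) , (λ i → i , corner-eq i)
    ; 0<r = 0<r ; 0<t = 0<t
    ; norm₁ = norm₁ ; norm₂ = norm₂
    ; det± = det-sign D (≡.sym Δ≡)
    ; side₁ = 0F , length₁
    ; side₂ = 1F , length₂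
    ; lengths = λ k (i , eq) → lengths k {side P i} (sides i) eq
    ; verticals = λ (i , eq) → Sum.map (λ s → ≈±-vertical {side P i} {a} {b} s eq) (λ s → ≈±-vertical {side P i} {c′} {d} s eq) (sides i)
    }
    where
    v : ∀ i → ∃[ a ] ∃[ b ] (P i ≈ᶜ vec a b)
    v i = ∈ℤ[ω]⇒vec (vertices i)
    x y : Fin 4 → ℤ
    x i = proj₁ (v i)
    y i = proj₁ (proj₂ (v i))
    a = x 1F ℤ.- x 0F
    b = y 1F ℤ.- y 0F
    c′ = x 2F ℤ.- x 1F
    d = y 2F ℤ.- y 1F
    difference : ∀ i j → P i -ᶜ P j ≈ᶜ vec (x i ℤ.- x j) (y i ℤ.- y j)
    difference i j =
      let ri , ii = proj₂ (proj₂ (v i))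
          rj , ij = proj₂ (proj₂ (v j))
      in ≈ᶜ-trans (+-cong ri (-‿cong rj) , +-cong ii (-‿cong ij)) (vec-- (x i) (y i) (x j) (y j))
    α≈ : P 1F -ᶜ P 0F ≈ᶜ vec a b
    α≈ = difference 1F 0F
    β≈ : P 2F -ᶜ P 1F ≈ᶜ vec c′ d
    β≈ = difference 2F 1F

    corner₁ : ∀ {p₀ p₁ A} → p₁ - p₀ ≈ A → p₁ ≈ p₀ + A
    corner₁ {p₀} {p₁} {A} e = linear (fromℤ (+ 1)) e
      (solve 3 (λ p₀ p₁ A → p₁ :- (p₀ :+ A) := con (+ 1) :* (p₁ :- p₀ :- A)) refl p₀ p₁ A)
    corner₂ : ∀ {p₀ p₁ p₂ A B} → p₁ - p₀ ≈ A → p₂ - p₁ ≈ B → p₂ ≈ p₀ + A + B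
    corner₂ {p₀} {p₁} {p₂} {A} {B} e f = linear₂ (fromℤ (+ 1)) (fromℤ (+ 1)) e f
      (solve 5 (λ p₀ p₁ p₂ A B → p₂ :- (p₀ :+ A :+ B) :=
        con (+ 1) :* (p₁ :- p₀ :- A) :+ con (+ 1) :* (p₂ :- p₁ :- B)) refl p₀ p₁ p₂ A B)
    corner₃ : ∀ {p₀ p₁ p₂ p₃ B} → p₂ - p₁ ≈ B → p₁ - p₀ ≈ p₂ - p₃ → p₃ ≈ p₀ + B
    corner₃ {p₀} {p₁} {p₂} {p₃} {B} e f = linear₂ (fromℤ (+ 1)) (fromℤ (+ 1)) e f
      (solve 5 (λ p₀ p₁ p₂ p₃ B → p₃ :- (p₀ :+ B) :=
        con (+ 1) :* (p₂ :- p₁ :- B) :+ con (+ 1) :* (p₁ :- p₀ :- (p₂ :- p₃))) refl p₀ p₁ p₂ p₃ B)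
    opposite₁ : ∀ {p₀ p₁ p₂ p₃ A} → p₁ - p₀ ≈ A → p₁ - p₀ ≈ p₂ - p₃ → p₃ - p₂ ≈ - A
    opposite₁ {p₀} {p₁} {p₂} {p₃} {A} e f = linear₂ (- fromℤ (+ 1)) (fromℤ (+ 1)) e f
      (solve 5 (λ p₀ p₁ p₂ p₃ A → p₃ :- p₂ :- :- A :=
        :- con (+ 1) :* (p₁ :- p₀ :- A) :+ con (+ 1) :* (p₁ :- p₀ :- (p₂ :- p₃))) refl p₀ p₁ p₂ p₃ A)
    opposite₂ : ∀ {p₀ p₁ p₂ p₃ B} → p₂ - p₁ ≈ B → p₁ - p₀ ≈ p₂ - p₃ → p₀ - p₃ ≈ - B
    opposite₂ {p₀} {p₁} {p₂} {p₃} {B} e f = linear₂ (- fromℤ (+ 1)) (- fromℤ (+ 1)) e f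
      (solve 5 (λ p₀ p₁ p₂ p₃ B → p₀ :- p₃ :- :- B :=
        :- con (+ 1) :* (p₂ :- p₁ :- B) :+ :- con (+ 1) :* (p₁ :- p₀ :- (p₂ :- p₃))) refl p₀ p₁ p₂ p₃ B)

    corner-eq : ∀ i → P i ≈ᶜ corner (P 0F) (vec a b) (vec c′ d) i
    corner-eq 0F = ≈ᶜ-refl
    corner-eq 1F = corner₁ (proj₁ α≈) , corner₁ (proj₂ α≈)
    corner-eq 2F = corner₂ (proj₁ α≈) (proj₁ β≈) , corner₂ (proj₂ α≈) (proj₂ β≈)
    corner-eq 3F = corner₃ (proj₁ β≈) (proj₁ parallel) , corner₃ (proj₂ β≈) (proj₂ parallel)

    sides : ∀ i → side P i ≈± vec a b ⊎ side P i ≈± vec c′ d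
    sides 0F = inj₁ (inj₁ α≈)
    sides 1F = inj₂ (inj₁ β≈)
    sides 2F = inj₁ (inj₂ (opposite₁ (proj₁ α≈) (proj₁ parallel) , opposite₁ (proj₂ α≈) (proj₂ parallel)))
    sides 3F = inj₂ (inj₂ (opposite₂ (proj₁ β≈) (proj₁ parallel) , opposite₂ (proj₂ β≈) (proj₂ parallel)))

    n₁ = norm a b
    n₂ = norm c′ d
    D = det a b c′ d
    Δ = + ℤ.∣ D ∣
    S = √ fromℤ n₁
    T = √ fromℤ n₂
    κ = ½ * √3
    cr = cross (side P 0F) (side P 1F)
    cross≈ : cr ≈ fromℤ D * κ
    cross≈ = trans
      (+-cong (*-cong (proj₁ α≈) (proj₂ β≈)) (-‿cong (*-cong (proj₂ α≈) (proj₁ β≈)))) (vec-cross a b c′ d)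
    D≢0 : D ≢ ℤ.0ℤ
    D≢0 D≡0 = #-irrefl (trans cross≈ (trans (*-congʳ (fromℤ-cong D≡0)) (zeroˡ κ))) nondegenerate
    0<Δ : ℤ.0ℤ ℤ.< Δ
    0<Δ = 0<abs D≢0
    Δ≢0 : Δ ≢ ℤ.0ℤ
    Δ≢0 Δ≡0 = D≢0 (ℤ.∣i∣≡0⇒i≡0 (ℤ.+-injective Δ≡0))
    area≈ : area P ≈ fromℤ Δ * κ
    area≈ = √-unique (*-pos (fromℤ-pos 0<Δ) (*-pos 0<½ 0<√3)) (trans (*-cong cross≈ cross≈)
      (trans (regroup (fromℤ D) κ) (trans (*-congʳ DD≈ΔΔ) (sym (regroup (fromℤ Δ) κ)))))
      where
      regroup : ∀ x k → x * k * (x * k) ≈ x * x * (k * k)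
      regroup = solve 2 (λ x k → x :* k :* (x :* k) := x :* x :* (k :* k)) refl
      DD≈ΔΔ : fromℤ D * fromℤ D ≈ fromℤ Δ * fromℤ Δ
      DD≈ΔΔ = trans (sym (fromℤ-* D D)) (trans (fromℤ-cong (≡.sym (abs-square D))) (fromℤ-* Δ Δ))
    modulus₀ : modulus (side P 0F) ≈ S
    modulus₀ = ≈±-modulus {side P 0F} {a} {b} (inj₁ α≈)
    modulus₁ : modulus (side P 1F) ≈ T
    modulus₁ = ≈±-modulus {side P 1F} {c′} {d} (inj₁ β≈)
    perimeter≈ : perimeter P ≈ S + (T + (S + (T + 0#)))
    perimeter≈ = +-cong modulus₀ (+-cong modulus₁ (+-cong
      (≈±-modulus {side P 2F} {a} {b}
        (inj₂ (opposite₁ (proj₁ α≈) (proj₁ parallel) , opposite₁ (proj₂ α≈) (proj₂ parallel))))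
      (+-cong (≈±-modulus {side P 3F} {c′} {d}
        (inj₂ (opposite₂ (proj₁ β≈) (proj₁ parallel) , opposite₂ (proj₂ β≈) (proj₂ parallel)))) refl)))
    -- The perimeter is 2(S + T) and the area Δ · √3 / 2; doubling removes the half.
    equable₁ : fromℤ (+ 4) * (S + T) ≈ √3 * fromℤ Δ
    equable₁ = linear₂ (fromℤ (+ 2)) (fromℤ Δ * √3)
      (trans (sym perimeter≈) (trans equable area≈)) 2½≈1
      (solve 5 (λ S T D h s → con (+ 4) :* (S :+ T) :- s :* D :=
        con (+ 2) :* (S :+ (T :+ (S :+ (T :+ con (+ 0)))) :- D :* (h :* s)) :+
        D :* s :* (con (+ 2) :* h :- con (+ 1))) refl S T (fromℤ Δ) ½ √3)
    equable₂ : fromℤ (+ 4) * (T + S) ≈ √3 * fromℤ Δ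
    equable₂ = trans (*-congˡ (+-comm T S)) equable₁
    root₂ = √-rational n₁ n₂ Δ (0≤norm a b) (0≤norm c′ d) Δ≢0 equable₁
    root₁ = √-rational n₂ n₁ Δ (0≤norm c′ d) (0≤norm a b) Δ≢0 equable₂
    r = proj₁ root₁
    t = proj₁ root₂
    norm₁ : n₁ ≡ + r ℤ.* + r ℤ.* + 3
    norm₁ = proj₂ root₁
    norm₂ : n₂ ≡ + t ℤ.* + t ℤ.* + 3
    norm₂ = proj₂ root₂
    q = inner a b c′ d
    positive : ∀ {n} k → n ≢ ℤ.0ℤ → n ≡ + k ℤ.* + k ℤ.* + 3 → ℤ.0ℤ ℤ.< + k
    positive ℕ.zero    n≢0 eq = ⊥-elim (n≢0 eq)
    positive (ℕ.suc _) _   _  = 0<+suc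
    0<r : ℤ.0ℤ ℤ.< + r
    0<r = positive r (factor≢0 {n₁} {n₂} {q} {D} D≢0 (lagrange a b c′ d)) norm₁
    0<t : ℤ.0ℤ ℤ.< + t
    0<t = positive t (factor≢0 {n₂} {n₁} {q} {D} D≢0
      (≡.trans (lagrange a b c′ d) (≡.cong (+ 4 ℤ.*_) (ℤ.*-comm n₁ n₂)))) norm₂
    S≈ : S ≈ fromℤ (+ r) * √3
    S≈ = √-3square 0<r norm₁
    T≈ : T ≈ fromℤ (+ t) * √3
    T≈ = √-3square 0<t norm₂
    length₁ : modulus (side P 0F) ≈ fromℤ (+ r) * √3
    length₁ = trans modulus₀ S≈
    length₂ : modulus (side P 1F) ≈ fromℤ (+ t) * √3
    length₂ = trans modulus₁ T≈
    cancel-√3 : ∀ {i j} → fromℤ i * √3 ≈ fromℤ j * √3 → i ≡ j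
    cancel-√3 {i} {j} eq = fromℤ-injective (*-cancelˡ-≈ (0<x⇒x#0 0<√3)
      (trans (*-comm √3 (fromℤ i)) (trans eq (*-comm (fromℤ j) √3))))
    Δ≡ : + 4 ℤ.* (+ r ℤ.+ + t) ≡ Δ
    Δ≡ = cancel-√3 (trans (*-congʳ (fromℤ-eval (con (+ 4) :* (var 0F :+ var 1F)) (+ r ∷ + t ∷ [])))
      (trans (linear₂ (- fromℤ (+ 4)) (- fromℤ (+ 4)) S≈ T≈
        (solve 5 (λ r t s S T → con (+ 4) :* (r :+ t) :* s :- con (+ 4) :* (S :+ T) :=
          :- con (+ 4) :* (S :- r :* s) :+ :- con (+ 4) :* (T :- t :* s))
          refl (fromℤ (+ r)) (fromℤ (+ t)) √3 S T))
      (trans equable₁ (*-comm √3 (fromℤ Δ)))))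
    det-sign : ∀ D {s} → + ℤ.∣ D ∣ ≡ s → D ≡ s ⊎ D ≡ ℤ.- s
    det-sign (+ _)    eq = inj₁ eq
    det-sign -[1+ _ ] eq = inj₂ (≡.cong ℤ.-_ eq)
    lengths : ∀ k {z} → z ≈± vec a b ⊎ z ≈± vec c′ d → modulus z ≈ fromℤ k * √3 → k ≡ + r ⊎ k ≡ + t
    lengths k {z} (inj₁ z≈) eq = inj₁ (cancel-√3 (trans (sym eq) (trans (≈±-modulus {z} {a} {b} z≈) S≈)))
    lengths k {z} (inj₂ z≈) eq = inj₂ (cancel-√3 (trans (sym eq) (trans (≈±-modulus {z} {c′} {d} z≈) T≈)))

-- The defining sequences solve their Pell equations

u-m-positive : ∀ n → ℤ.0ℤ ℤ.< u (ℕ.suc n) × ℤ.0ℤ ℤ.< m (ℕ.suc n)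
u-m-positive ℕ.zero = 0<+suc , 0<+suc
u-m-positive (ℕ.suc n) =
  let 0<u , 0<m = u-m-positive n
      u≡ , m≡   = linear-recurrence (ℕ.suc n)
  in ≡.subst (ℤ.0ℤ ℤ.<_) (≡.sym u≡) (0<-+ (0<-* {+ 5} 0<+suc 0<u) (0≤-* {+ 4} 0≤+ (ℤ.<⇒≤ 0<m))) ,
     ≡.subst (ℤ.0ℤ ℤ.<_) (≡.sym m≡) (0<-+ (0<-* {+ 6} 0<+suc 0<u) (0≤-* {+ 5} 0≤+ (ℤ.<⇒≤ 0<m)))

u-m-pell : ∀ n → + 3 ℤ.* (u n ℤ.* u n) ≡ + 2 ℤ.* (m n ℤ.* m n) ℤ.+ + 1
u-m-pell ℕ.zero = ≡.refl
u-m-pell (ℕ.suc n) =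
  let u≡ , m≡ = linear-recurrence n
  in ≡.subst₂ (λ u m → + 3 ℤ.* (u ℤ.* u) ≡ + 2 ℤ.* (m ℤ.* m) ℤ.+ + 1) (≡.sym u≡) (≡.sym m≡) (step (u n) (m n) (u-m-pell n))
  where
  step : ∀ u m → + 3 ℤ.* (u ℤ.* u) ≡ + 2 ℤ.* (m ℤ.* m) ℤ.+ + 1 →
         let u′ = + 5 ℤ.* u ℤ.+ + 4 ℤ.* m ; m′ = + 6 ℤ.* u ℤ.+ + 5 ℤ.* m in
         + 3 ℤ.* (u′ ℤ.* u′) ≡ + 2 ℤ.* (m′ ℤ.* m′) ℤ.+ + 1
  step u m eq = Integers.linear (+ 1) eq (ℤ-Solver.solve (u List.∷ m List.∷ List.[]))

record Solution₄ (s : ℤ × ℤ) : Set where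
  constructor solution₄
  field
    0<w : ℤ.0ℤ ℤ.< proj₁ s
    0<v : ℤ.0ℤ ℤ.< proj₂ s
    eq  : + 132 ℤ.* (proj₁ s ℤ.* proj₁ s) ℤ.+ + 36 ℤ.* proj₁ s ℤ.+ + 1 ≡ proj₂ s ℤ.* proj₂ s

-- The equation is (132w + 18)² - 132v² = 192, and the recurrence multiplies (132w + 18) + v√132 by
-- the norm-one element 23 + 2√132. The shift by 18 produces the constants 3 and 36.
wy-solution : ∀ s → Solution₄ s → ∀ n → Solution₄ (wy s (ℕ.suc n))
wy-solution s sol ℕ.zero    = sol
wy-solution s sol (ℕ.suc n) with wy s (ℕ.suc n) | wy-solution s sol n
... | w , v | solution₄ 0<w 0<v eq = solution₄
  (0<-+ (0<-+ (0<-* {+ 23} 0<+suc 0<w) (0≤-* {+ 2} 0≤+ (ℤ.<⇒≤ 0<v))) (0≤+ {3}))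
  (0<-+ (0<-+ (0<-* {+ 264} 0<+suc 0<w) (0≤-* {+ 23} 0≤+ (ℤ.<⇒≤ 0<v))) (0≤+ {36}))
  (step w v eq)
  where
  step : ∀ w v → + 132 ℤ.* (w ℤ.* w) ℤ.+ + 36 ℤ.* w ℤ.+ + 1 ≡ v ℤ.* v →
         let w′ = + 23 ℤ.* w ℤ.+ + 2 ℤ.* v ℤ.+ + 3 ; v′ = + 264 ℤ.* w ℤ.+ + 23 ℤ.* v ℤ.+ + 36 in
         + 132 ℤ.* (w′ ℤ.* w′) ℤ.+ + 36 ℤ.* w′ ℤ.+ + 1 ≡ v′ ℤ.* v′
  step w v eq = Integers.linear (+ 1) eq (ℤ-Solver.solve (w List.∷ v List.∷ List.[]))

abs-of-vertical-norm : ∀ {a r} → ℤ.0ℤ ℤ.< r → norm a (+ 2 ℤ.* a) ≡ r ℤ.* r ℤ.* + 3 → + ℤ.∣ a ∣ ≡ r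
abs-of-vertical-norm {a} {r} 0<r eq = abs-≡ (ℤ.<⇒≤ 0<r)
  (square≡⇒≡± {a} {r} (ℤ.*-cancelˡ-≡ (+ 3) (a ℤ.* a) (r ℤ.* r) (3aa≡3rr a r eq)))
  where
  3aa≡3rr : ∀ a r → a ℤ.* a ℤ.- a ℤ.* (+ 2 ℤ.* a) ℤ.+ (+ 2 ℤ.* a) ℤ.* (+ 2 ℤ.* a) ≡ r ℤ.* r ℤ.* + 3 →
            + 3 ℤ.* (a ℤ.* a) ≡ + 3 ℤ.* (r ℤ.* r)
  3aa≡3rr a r eq = Integers.linear (+ 1) eq (ℤ-Solver.solve (a List.∷ r List.∷ List.[]))

vertical-side-of-length : ∀ {a b c d r t} → b ≡ + 2 ℤ.* a → ℤ.0ℤ ℤ.< r → ℤ.0ℤ ℤ.< t →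
  norm a b ≡ r ℤ.* r ℤ.* + 3 → norm c d ≡ t ℤ.* t ℤ.* + 3 →
  det a b c d ≡ + 4 ℤ.* (r ℤ.+ t) ⊎ det a b c d ≡ ℤ.- (+ 4 ℤ.* (r ℤ.+ t)) →
  r ≡ + 2 ⊎ r ≡ + 4
vertical-side-of-length {a} {c = c} {d} {t = t} ≡.refl 0<r 0<t norm₁ norm₂ det±
  with abs-of-vertical-norm {a} 0<r norm₁
... | ≡.refl = vertical-side-length a c d t (ℤ.<⇒≤ 0<t) (0<-+ 0<r (ℤ.<⇒≤ 0<t)) norm₂ det±

-- The families are equable and exhaust the cases

module Classification {ℓ₀ ℓ₁ ℓ₂ : Level} (ℝ : Reals ℓ₀ ℓ₁ ℓ₂) where
  open Reals ℝ
  open Plane ℝ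
  open RealField ℝ
  open PlaneGeometry ℝ
  open LatticeVectors ℝ
  open Analysis ℝ

  -- `t` is the length of the slanted side in units of √3, as `side-norm` says; `equable-side` is
  -- perimeter = area divided by √3.
  module VerticalParallelogram
    (k x y t : ℤ) (0<k : ℤ.0ℤ ℤ.< k) (0<x : ℤ.0ℤ ℤ.< x) (0<t : ℤ.0ℤ ℤ.< t)
    (side-norm : x ℤ.* x ℤ.+ + 3 ℤ.* (y ℤ.* y) ≡ + 3 ℤ.* (t ℤ.* t))
    (equable-side : + 2 ℤ.* k ℤ.+ + 2 ℤ.* t ≡ k ℤ.* x)
    where

    V = verticalParallelogram k x y
    K = fromℤ k
    X = fromℤ x
    Y = fromℤ y
    T = fromℤ t
    s = √3

    side-norm′ : X * X + fromℤ (+ 3) * (Y * Y) ≈ fromℤ (+ 3) * (T * T)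
    side-norm′ = trans (sym (fromℤ-eval (var 0F :* var 0F :+ con (+ 3) :* (var 1F :* var 1F)) (x ∷ y ∷ [])))
      (trans (fromℤ-cong side-norm) (fromℤ-eval (con (+ 3) :* (var 0F :* var 0F)) (t ∷ [])))
    equable-side′ : fromℤ (+ 2) * K + fromℤ (+ 2) * T ≈ K * X
    equable-side′ = trans (sym (fromℤ-eval (con (+ 2) :* var 0F :+ con (+ 2) :* var 1F) (k ∷ t ∷ [])))
      (trans (fromℤ-cong equable-side) (fromℤ-* k x))

    ky≈ : fromℤ (k ℤ.+ y) ≈ K + Y
    ky≈ = fromℤ-+ k y
    x′≈ : fromℤ (ℤ.- x) ≈ - X
    x′≈ = fromℤ-neg x

    side₀ : side V 0F ≈ᶜ 0# +i (K * s)
    side₀ = solve 0 (con (+ 0) :- con (+ 0) := con (+ 0)) refl ,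
            solve 2 (λ k s → k :* s :- con (+ 0) :* s := k :* s) refl K s
    side₁ : side V 1F ≈ᶜ (- X) +i (Y * s)
    side₁ = trans (+-congʳ x′≈) (solve 1 (λ x → :- x :- con (+ 0) := :- x) refl X) ,
            trans (+-congʳ (*-congʳ ky≈)) (solve 3 (λ k y s → (k :+ y) :* s :- k :* s := y :* s) refl K Y s)
    side₂ : side V 2F ≈ᶜ 0# +i (- (K * s))
    side₂ = solve 1 (λ x → x :- x := con (+ 0)) refl (fromℤ (ℤ.- x)) ,
            trans (+-congˡ (-‿cong (*-congʳ ky≈)))
              (solve 3 (λ k y s → y :* s :- (k :+ y) :* s := :- (k :* s)) refl K Y s)
    side₃ : side V 3F ≈ᶜ X +i (- (Y * s))
    side₃ = trans (+-congˡ (-‿cong x′≈)) (solve 1 (λ x → con (+ 0) :- :- x := x) refl X) ,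
            solve 2 (λ y s → con (+ 0) :* s :- y :* s := :- (y :* s)) refl Y s

    length-K : ∀ {z} → normSq z ≈ K * s * (K * s) → modulus z ≈ K * s
    length-K = √-unique (*-pos (fromℤ-pos 0<k) 0<√3)
    length-T : ∀ {z} → normSq z ≈ T * s * (T * s) → modulus z ≈ T * s
    length-T = √-unique (*-pos (fromℤ-pos 0<t) 0<√3)

    β-normSq : X * X + (Y * s) * (Y * s) ≈ T * s * (T * s)
    β-normSq = linear₂ (Y * Y - T * T) (fromℤ (+ 1)) √3²≈3 side-norm′
      (solve 4 (λ x y t s → x :* x :+ (y :* s) :* (y :* s) :- t :* s :* (t :* s) :=
        (y :* y :- t :* t) :* (s :* s :- con (+ 3)) :+
        con (+ 1) :* (x :* x :+ con (+ 3) :* (y :* y) :- con (+ 3) :* (t :* t))) refl X Y T s)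

    length₀ : modulus (side V 0F) ≈ K * s
    length₀ = length-K {side V 0F} (trans (normSq-cong side₀)
      (solve 1 (λ a → con (+ 0) :* con (+ 0) :+ a :* a := a :* a) refl (K * s)))
    length₁ : modulus (side V 1F) ≈ T * s
    length₁ = length-T {side V 1F} (trans (normSq-cong side₁)
      (trans (solve 2 (λ x a → :- x :* :- x :+ a :* a := x :* x :+ a :* a) refl X (Y * s)) β-normSq))
    length₂ : modulus (side V 2F) ≈ K * s
    length₂ = length-K {side V 2F} (trans (normSq-cong side₂)
      (solve 1 (λ a → con (+ 0) :* con (+ 0) :+ :- a :* :- a := a :* a) refl (K * s)))
    length₃ : modulus (side V 3F) ≈ T * s
    length₃ = length-T {side V 3F} (trans (normSq-cong side₃)
      (trans (solve 2 (λ x a → x :* x :+ :- a :* :- a := x :* x :+ a :* a) refl X (Y * s)) β-normSq))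

    cross≈ : cross (side V 0F) (side V 1F) ≈ K * X * s
    cross≈ = trans
      (+-cong (*-cong (proj₁ side₀) (proj₂ side₁)) (-‿cong (*-cong (proj₂ side₀) (proj₁ side₁))))
      (solve 4 (λ k x y s → con (+ 0) :* (y :* s) :- k :* s :* :- x := k :* x :* s) refl K X Y s)

    0<area : 0# < K * X * s
    0<area = *-pos (*-pos (fromℤ-pos 0<k) (fromℤ-pos 0<x)) 0<√3

    area≈ : area V ≈ K * X * s
    area≈ = √-unique 0<area (*-cong cross≈ cross≈)

    perimeter≈area : perimeter V ≈ area V
    perimeter≈area = trans
      (+-cong length₀ (+-cong length₁ (+-cong length₂ (+-cong length₃ refl))))
      (trans (linear s equable-side′
        (solve 4 (λ k x t s →
          k :* s :+ (t :* s :+ (k :* s :+ (t :* s :+ con (+ 0)))) :- k :* x :* s :=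
          s :* (con (+ 2) :* k :+ con (+ 2) :* t :- k :* x)) refl K X T s))
      (sym area≈))

    parallel : V 1F -ᶜ V 0F ≈ᶜ V 2F -ᶜ V 3F
    parallel = ≈ᶜ-trans side₀
      ( solve 1 (λ x → con (+ 0) := x :- x) refl (fromℤ (ℤ.- x))
      , sym (trans (+-congʳ (*-congʳ ky≈)) (solve 3 (λ k y s → (k :+ y) :* s :- y :* s := k :* s) refl K Y s)))

    ⊹√3i∈ℤ[ω] : ∀ a b → (a ⊹ b √3i) ∈ℤ[ω]
    -- √3 i = 1 + 2ω.
    ⊹√3i∈ℤ[ω] a b = a ℤ.+ b , + 2 ℤ.* b ,
      linear₃ (- fromℤ (+ 1)) ½ (fromℤ b) (fromℤ-+ a b) (fromℤ-* (+ 2) b) 2½≈1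
        (solve 6 (λ a b a+b 2b h s →
          a :- (a+b :+ (2b :* :- h :- con (+ 0) :* (h :* s))) :=
          :- con (+ 1) :* (a+b :- (a :+ b)) :+ h :* (2b :- con (+ 2) :* b) :+ b :* (con (+ 2) :* h :- con (+ 1)))
          refl (fromℤ a) (fromℤ b) (fromℤ (a ℤ.+ b)) (fromℤ (+ 2 ℤ.* b)) ½ √3) ,
      linear₂ (- (½ * √3)) (- (fromℤ b * √3)) (fromℤ-* (+ 2) b) 2½≈1
        (solve 4 (λ b 2b h s →
          b :* s :- (con (+ 0) :+ (2b :* (h :* s) :+ con (+ 0) :* :- h)) :=
          :- (h :* s) :* (2b :- con (+ 2) :* b) :+ :- (b :* s) :* (con (+ 2) :* h :- con (+ 1)))
          refl (fromℤ b) (fromℤ (+ 2 ℤ.* b)) ½ √3)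

    vertices : ∀ i → V i ∈ℤ[ω]
    vertices 0F = ⊹√3i∈ℤ[ω] (+ 0) (+ 0)
    vertices 1F = ⊹√3i∈ℤ[ω] (+ 0) k
    vertices 2F = ⊹√3i∈ℤ[ω] (ℤ.- x) (k ℤ.+ y)
    vertices 3F = ⊹√3i∈ℤ[ω] (ℤ.- x) y

    isELEP : IsELEP V × HasSideOfLength (K * √3) V
    isELEP = ((parallel , 0<x⇒x#0 (<-respʳ-≈ (sym cross≈) 0<area)) , vertices , perimeter≈area) , 0F , length₀

  Q-isELEP : ∀ n → IsELEP (Q (ℕ.suc n)) × HasSideOfLength 2√3 (Q (ℕ.suc n))
  Q-isELEP n = VerticalParallelogram.isELEP (+ 2) (+ 3 ℤ.+ + 3 ℤ.* u (ℕ.suc n)) (+ 2 ℤ.* m (ℕ.suc n))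
    -- The slanted side: 4 + 2t = 2(3 + 3u) gives t = 1 + 3u.
    (+ 1 ℤ.+ + 3 ℤ.* u (ℕ.suc n)) 0<+suc (0<-+ {+ 3} 0<+suc 0≤3u) (0<-+ {+ 1} 0<+suc 0≤3u)
    (side-norm (u (ℕ.suc n)) (m (ℕ.suc n)) (u-m-pell (ℕ.suc n)))
    (equable-side (u (ℕ.suc n)))
    where
    0≤3u : ℤ.0ℤ ℤ.≤ + 3 ℤ.* u (ℕ.suc n)
    0≤3u = 0≤-* {+ 3} 0≤+ (ℤ.<⇒≤ (proj₁ (u-m-positive n)))
    side-norm : ∀ u m → + 3 ℤ.* (u ℤ.* u) ≡ + 2 ℤ.* (m ℤ.* m) ℤ.+ + 1 →
      (+ 3 ℤ.+ + 3 ℤ.* u) ℤ.* (+ 3 ℤ.+ + 3 ℤ.* u) ℤ.+ + 3 ℤ.* (+ 2 ℤ.* m ℤ.* (+ 2 ℤ.* m)) ≡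
      + 3 ℤ.* ((+ 1 ℤ.+ + 3 ℤ.* u) ℤ.* (+ 1 ℤ.+ + 3 ℤ.* u))
    side-norm u m eq = Integers.linear (ℤ.- + 6) eq (ℤ-Solver.solve (u List.∷ m List.∷ List.[]))
    equable-side : ∀ u → + 4 ℤ.+ + 2 ℤ.* (+ 1 ℤ.+ + 3 ℤ.* u) ≡ + 2 ℤ.* (+ 3 ℤ.+ + 3 ℤ.* u)
    equable-side = ℤ-Solver.solve-∀

  family-isELEP : ∀ s → Solution₄ s → ∀ n →
    IsELEP (familyWithSide4√3 s (ℕ.suc n)) × HasSideOfLength 4√3 (familyWithSide4√3 s (ℕ.suc n))
  family-isELEP s sol n with wy s (ℕ.suc n) | wy-solution s sol n
  ... | w , v | solution₄ 0<w 0<v eq = VerticalParallelogram.isELEP (+ 4) (+ 6 ℤ.* w ℤ.+ + 3) v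
    -- 8 + 2t = 4(6w + 3) gives t = 12w + 2.
    (+ 12 ℤ.* w ℤ.+ + 2) 0<+suc (0<-+ (0<-* {+ 6} 0<+suc 0<w) (0≤+ {3})) (0<-+ (0<-* {+ 12} 0<+suc 0<w) (0≤+ {2}))
    (side-norm w v eq) (equable-side w)
    where
    side-norm : ∀ w v → + 132 ℤ.* (w ℤ.* w) ℤ.+ + 36 ℤ.* w ℤ.+ + 1 ≡ v ℤ.* v →
      (+ 6 ℤ.* w ℤ.+ + 3) ℤ.* (+ 6 ℤ.* w ℤ.+ + 3) ℤ.+ + 3 ℤ.* (v ℤ.* v) ≡
      + 3 ℤ.* ((+ 12 ℤ.* w ℤ.+ + 2) ℤ.* (+ 12 ℤ.* w ℤ.+ + 2))
    side-norm w v eq = Integers.linear (ℤ.- + 3) eq (ℤ-Solver.solve (w List.∷ v List.∷ List.[]))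
    equable-side : ∀ w → + 8 ℤ.+ + 2 ℤ.* (+ 12 ℤ.* w ℤ.+ + 2) ≡ + 4 ℤ.* (+ 6 ℤ.* w ℤ.+ + 3)
    equable-side = ℤ-Solver.solve-∀

  with-side : ∀ {P} k → IsELEP P → HasSideOfLength (fromℤ k * √3) P → ∃[ L ] Lattice.r {P} L ≡ k
  with-side {P} k elep h with lattice P elep
  ... | L with Lattice.lengths L k h
  ...   | inj₁ k≡r = L , ≡.sym k≡r
  ...   | inj₂ k≡t = swap-lattice L , ≡.sym k≡t

  module _ {P} (L : Lattice P) where
    open Lattice L

    gram : ∀ {k} → r ≡ k → inner a b c d ℤ.* inner a b c d ℤ.+
           + 3 ℤ.* ((+ 4 ℤ.* (k ℤ.+ t)) ℤ.* (+ 4 ℤ.* (k ℤ.+ t))) ≡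
           + 4 ℤ.* ((k ℤ.* k ℤ.* + 3) ℤ.* (t ℤ.* t ℤ.* + 3))
    gram ≡.refl = ≡.trans (≡.cong (λ z → inner a b c d ℤ.* inner a b c d ℤ.+ + 3 ℤ.* z) (≡.sym (square± det±)))
      (≡.trans (lagrange a b c d) (≡.cong₂ (λ x y → + 4 ℤ.* (x ℤ.* y)) norm₁ norm₂))
      where
      square-neg : ∀ s → ℤ.- s ℤ.* ℤ.- s ≡ s ℤ.* s
      square-neg = ℤ-Solver.solve-∀
      square± : ∀ {D s} → D ≡ s ⊎ D ≡ ℤ.- s → D ℤ.* D ≡ s ℤ.* s
      square± (inj₁ ≡.refl)             = ≡.refl
      square± {s = s} (inj₂ ≡.refl) = square-neg s

    lattice-congruent : ∀ {k} x v → r ≡ k → + 4 ℤ.* (k ℤ.+ t) ≡ + 2 ℤ.* k ℤ.* x →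
      inner a b c d ≡ + 6 ℤ.* k ℤ.* v ⊎ inner a b c d ≡ ℤ.- (+ 6 ℤ.* k ℤ.* v) →
      P ≅ verticalParallelogram k x v
    lattice-congruent x v ≡.refl D≡ inner± =
      congruent-to-vertical {P} {p} {a} {b} {c} {d} r x v 0<r norm₁ (along det±) inner± spanned
      where
      along : ∀ {D} → D ≡ + 4 ℤ.* (r ℤ.+ t) ⊎ D ≡ ℤ.- (+ 4 ℤ.* (r ℤ.+ t)) →
              D ≡ + 2 ℤ.* r ℤ.* x ⊎ D ≡ ℤ.- (+ 2 ℤ.* r ℤ.* x)
      along (inj₁ e) = inj₁ (≡.trans e D≡)
      along (inj₂ e) = inj₂ (≡.trans e (≡.cong ℤ.-_ D≡))

    vertical⇒side : b ≡ + 2 ℤ.* a → HasSideOfLength 2√3 P ⊎ HasSideOfLength 4√3 P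
    vertical⇒side b≡2a = Sum.map
      (λ r≡2 → ≡.subst (λ r → HasSideOfLength (fromℤ r * √3) P) r≡2 side₁)
      (λ r≡4 → ≡.subst (λ r → HasSideOfLength (fromℤ r * √3) P) r≡4 side₁)
      (vertical-side-of-length b≡2a 0<r 0<t norm₁ norm₂ det±)

  side2√3⇒Q : ∀ P → IsELEP P → HasSideOfLength 2√3 P → ∃[ n ] ((1 ℕ.≤ n) × (P ≅ Q n))
  side2√3⇒Q P elep h with with-side {P} (+ 2) elep h
  ... | L , r≡2 = go (sideSolution₂ t (inner a b c d) (ℤ.<⇒≤ 0<t) (≡.trans (gram L r≡2) (simplify t)))
    where
    open Lattice L
    simplify : ∀ t → + 4 ℤ.* (+ 12 ℤ.* (t ℤ.* t ℤ.* + 3)) ≡ + 144 ℤ.* (t ℤ.* t)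
    simplify = ℤ-Solver.solve-∀
    go : SideSolution (+ 2) (+ 4 ℤ.* (+ 2 ℤ.+ t)) (inner a b c d) → ∃[ n ] ((1 ℕ.≤ n) × (P ≅ Q n))
    go sol =
      let module S = SideSolution sol
          n , X≡ , y≡ = solutions₂ {S.X} {S.y} S.equable S.2≤X S.0≤y
          U = u (ℕ.suc n)
          M = m (ℕ.suc n)
      in ℕ.suc n , ℕ.s≤s ℕ.z≤n ,
         lattice-congruent L (+ 3 ℤ.+ + 3 ℤ.* U) (+ 2 ℤ.* M) r≡2
           (≡.trans S.D≡ (≡.trans (≡.cong (+ 6 ℤ.*_) X≡) (det-eq U)))
           (≡.subst (λ q → inner a b c d ≡ q ⊎ inner a b c d ≡ ℤ.- q)
             (≡.trans (≡.cong (+ 6 ℤ.*_) y≡) (inner-eq M)) S.q≡)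
      where
      det-eq : ∀ u → + 6 ℤ.* (+ 2 ℤ.+ + 2 ℤ.* u) ≡ + 4 ℤ.* (+ 3 ℤ.+ + 3 ℤ.* u)
      det-eq = ℤ-Solver.solve-∀
      inner-eq : ∀ m → + 6 ℤ.* (+ 4 ℤ.* m) ≡ + 12 ℤ.* (+ 2 ℤ.* m)
      inner-eq = ℤ-Solver.solve-∀

  -- The extra alternative is genuine: `Q 1` has sides 2√3 and 4√3, whereas in `R` and `R′` the
  -- other side is (12w + 2)√3 with w ≥ 1.
  side4√3⇒R : ∀ P → IsELEP P → HasSideOfLength 4√3 P →
              (∃[ n ] ((1 ℕ.≤ n) × ((P ≅ R n) ⊎ (P ≅ R′ n)))) ⊎ (P ≅ Q 1)
  side4√3⇒R P elep h with with-side {P} (+ 4) elep h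
  ... | L , r≡4 = go (sideSolution₄ t (inner a b c d) (ℤ.<⇒≤ 0<t) (≡.trans (gram L r≡4) (simplify t)))
    where
    open Lattice L
    simplify : ∀ t → + 4 ℤ.* (+ 48 ℤ.* (t ℤ.* t ℤ.* + 3)) ≡ + 576 ℤ.* (t ℤ.* t)
    simplify = ℤ-Solver.solve-∀
    go : SideSolution (+ 4) (+ 4 ℤ.* (+ 4 ℤ.+ t)) (inner a b c d) →
         (∃[ n ] ((1 ℕ.≤ n) × ((P ≅ R n) ⊎ (P ≅ R′ n)))) ⊎ (P ≅ Q 1)
    go sol = cases (solutions₄ {S.X} {S.y} S.equable S.2≤X S.0≤y)
      where
      module S = SideSolution sol
      det-eq : ∀ w → + 12 ℤ.* (+ 4 ℤ.* w ℤ.+ + 2) ≡ + 8 ℤ.* (+ 6 ℤ.* w ℤ.+ + 3)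
      det-eq = ℤ-Solver.solve-∀
      inner-eq : ∀ v → + 12 ℤ.* (+ 2 ℤ.* v) ≡ + 24 ℤ.* v
      inner-eq = ℤ-Solver.solve-∀
      inner-swap : ∀ a b c d →
        + 2 ℤ.* c ℤ.* a ℤ.- c ℤ.* b ℤ.- d ℤ.* a ℤ.+ + 2 ℤ.* d ℤ.* b ≡
        + 2 ℤ.* a ℤ.* c ℤ.- a ℤ.* d ℤ.- b ℤ.* c ℤ.+ + 2 ℤ.* b ℤ.* d
      inner-swap = ℤ-Solver.solve-∀
      in-family : ∀ s → InFamily₄ s S.X S.y → ∃[ n ] ((1 ℕ.≤ n) × (P ≅ familyWithSide4√3 s n))
      in-family s (n , X≡ , y≡) =
        let w , v = wy s (ℕ.suc n) in ℕ.suc n , ℕ.s≤s ℕ.z≤n ,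
        lattice-congruent L (+ 6 ℤ.* w ℤ.+ + 3) v r≡4
          (≡.trans S.D≡ (≡.trans (≡.cong (+ 12 ℤ.*_) X≡) (det-eq w)))
          (≡.subst (λ q → inner a b c d ≡ q ⊎ inner a b c d ≡ ℤ.- q)
             (≡.trans (≡.cong (+ 12 ℤ.*_) y≡) (inner-eq v)) S.q≡)
      t≡2 : S.X ≡ + 2 → t ≡ + 2
      t≡2 X≡2 = quotient t (≡.trans S.D≡ (≡.cong (+ 12 ℤ.*_) X≡2))
        where
        quotient : ∀ t → + 4 ℤ.* (+ 4 ℤ.+ t) ≡ + 24 → t ≡ + 2
        quotient t eq = ℤ.*-cancelˡ-≡ (+ 4) t (+ 2) (Integers.linear (+ 1) eq (ℤ-Solver.solve (t List.∷ List.[])))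
      cases : (S.X ≡ + 2 × S.y ≡ + 2) ⊎ (InFamily₄ (+ 1 , + 13) S.X S.y ⊎ InFamily₄ (+ 5 , + 59) S.X S.y) →
              (∃[ n ] ((1 ℕ.≤ n) × ((P ≅ R n) ⊎ (P ≅ R′ n)))) ⊎ (P ≅ Q 1)
      -- X = 2 gives t = 2, so after swapping, the short side is the vertical one. Then 4(2 + 4) = 4
      -- · 6 and 12 · 2 = 6 · 2 · 2 give x = 6 and y = 2, the parameters of `Q 1`.
      cases (inj₁ (X≡2 , y≡2)) = inj₂ (lattice-congruent (swap-lattice L) (+ 6) (+ 2) (t≡2 X≡2)
        (≡.cong (λ r → + 4 ℤ.* (+ 2 ℤ.+ r)) r≡4)
        (≡.subst₂ (λ i q → i ≡ q ⊎ i ≡ ℤ.- q) (≡.sym (inner-swap a b c d)) (≡.cong (+ 12 ℤ.*_) y≡2) S.q≡))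
      cases (inj₂ (inj₁ f)) = let n , 1≤n , P≅ = in-family _ f in inj₁ (n , 1≤n , inj₁ P≅)
      cases (inj₂ (inj₂ f)) = let n , 1≤n , P≅ = in-family _ f in inj₁ (n , 1≤n , inj₂ P≅)

  vertical⇒side2√3⊎4√3 : ∀ P → IsELEP P → HasVerticalSide P → HasSideOfLength 2√3 P ⊎ HasSideOfLength 4√3 P
  vertical⇒side2√3⊎4√3 P elep h with lattice P elep
  ... | L with Lattice.verticals L h
  ...   | inj₁ b≡2a = vertical⇒side L b≡2a
  ...   | inj₂ d≡2c = vertical⇒side (swap-lattice L) d≡2c

open import Data.Nat.Base using (_≤_)

theorem7 : ∀ {c ℓ₁ ℓ₂} (ℝ : Reals c ℓ₁ ℓ₂) → let open Plane ℝ in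
    (∀ n → 1 ≤ n → IsELEP (Q n) × HasSideOfLength 2√3 (Q n))
    × (∀ P → IsELEP P → HasSideOfLength 2√3 P → ∃[ n ] ((1 ≤ n) × (P ≅ Q n)))
    × (∀ n → 1 ≤ n → IsELEP (R n) × HasSideOfLength 4√3 (R n))
    × (∀ n → 1 ≤ n → IsELEP (R′ n) × HasSideOfLength 4√3 (R′ n))
    × (∀ P → IsELEP P → HasSideOfLength 4√3 P →
    (∃[ n ] ((1 ≤ n) × ((P ≅ R n) ⊎ (P ≅ R′ n)))) ⊎ (P ≅ Q 1))
    × (∀ P → IsELEP P → HasVerticalSide P →
    HasSideOfLength 2√3 P ⊎ HasSideOfLength 4√3 P)
theorem7 ℝ =
    (λ { (ℕ.suc n) _ → Q-isELEP n })
  , side2√3⇒Q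
  , (λ { (ℕ.suc n) _ → family-isELEP (+ 1 , + 13) (solution₄ 0<+suc 0<+suc ≡.refl) n })
  , (λ { (ℕ.suc n) _ → family-isELEP (+ 5 , + 59) (solution₄ 0<+suc 0<+suc ≡.refl) n })
  , side4√3⇒R
  , vertical⇒side2√3⊎4√3
  where open Classification ℝ
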